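{- For every chordless graph $G$ with maximum degree $\Delta$, the strong chromatic index satisfies $\chi'_s(G)\leq 3\Delta$.
   Context: All graphs are finite, simple and undirected. A graph is chordless if no cycle of the graph has a chord (an edge joining two non-consecutive vertices of the cycle). An induced matching is a set of pairwise vertex-disjoint edges such that no two endpoints belonging to different edges of the set are adjacent. A strong edge colouring of $G$ is an assignment of colours to the edges of $G$ such that each colour class is an induced matching; $\chi'_s(G)$ is the minimum number of colours in a strong edge colouring of $G$. -}

module Defs where

open import Data.Nat using (ℕ; zero; suc; _+_; _*_; _%_; _⊔_; _≤_)
open import Data.Fin using (Fin; toℕ)
open import Data.List using (List; map; foldr; allFin)
open import Data.Nat.ListAction using (sum)
open import Data.Bool using (if_then_else_)
open import Data.Product using (Σ; ∃; _×_; _,_)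
open import Data.Sum using (_⊎_)
open import Relation.Nullary using (¬_; does)
open import Relation.Binary using (Decidable)
open import Relation.Binary.PropositionalEquality using (_≡_)
open import Function.Definitions using (Injective)

record Graph (n : ℕ) : Set₁ where
  field
    Adj    : Fin n → Fin n → Set
    sym    : ∀ {u v} → Adj u v → Adj v u
    irrefl : ∀ {u} → ¬ Adj u u
    adj?   : Decidable Adj
open Graph public

degree : ∀ {n} → Graph n → Fin n → ℕ
degree {n} G v = sum (map (λ u → if does (adj? G v u) then 1 else 0) (allFin n))

maxDegree : ∀ {n} → Graph n → ℕ
maxDegree {n} G = foldr _⊔_ 0 (map (degree G) (allFin n))

Consecutive : ∀ {k} → Fin (suc k) → Fin (suc k) → Set
Consecutive {k} i j =
  (toℕ j ≡ suc (toℕ i) % suc k) ⊎ (toℕ i ≡ suc (toℕ j) % suc k)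

record Cycle {n : ℕ} (G : Graph n) : Set where
  field
    m     : ℕ
    c     : Fin (suc (suc (suc m))) → Fin n
    inj   : Injective _≡_ _≡_ c
    edges : ∀ i j → Consecutive i j → Adj G (c i) (c j)
open Cycle public

Chord : ∀ {n} {G : Graph n} → Cycle G → Set
Chord {G = G} C =
  Σ _ λ i → Σ _ λ j → ¬ Consecutive {suc (suc (m C))} i j × Adj G (c C i) (c C j)

Chordless : ∀ {n} → Graph n → Set
Chordless G = (C : Cycle G) → ¬ Chord C

record EdgeColouring {n : ℕ} (G : Graph n) (k : ℕ) : Set where
  field
    col  : ∀ u v → Adj G u v → Fin k
    symm : ∀ u v (p : Adj G u v) (q : Adj G v u) → col u v p ≡ col v u q
open EdgeColouring public

DistinctEdges : ∀ {n} → Fin n → Fin n → Fin n → Fin n → Set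
DistinctEdges u v x y = ¬ ((u ≡ x × v ≡ y) ⊎ (u ≡ y × v ≡ x))

InducedPair : ∀ {n} → Graph n → Fin n → Fin n → Fin n → Fin n → Set
InducedPair G u v x y =
  (¬ u ≡ x) × (¬ u ≡ y) × (¬ v ≡ x) × (¬ v ≡ y) ×
  (¬ Adj G u x) × (¬ Adj G u y) × (¬ Adj G v x) × (¬ Adj G v y)

IsStrong : ∀ {n} {G : Graph n} {k} → EdgeColouring G k → Set
IsStrong {G = G} φ =
  ∀ u v x y (p : Adj G u v) (q : Adj G x y) →
  DistinctEdges u v x y → col φ u v p ≡ col φ x y q → InducedPair G u v x y

-- χ'_s(G) ≤ k  :⇔  G has a strong edge colouring with (at most) k colours
StrongChromaticIndex≤ : ∀ {n} → Graph n → ℕ → Set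
StrongChromaticIndex≤ G k = Σ (EdgeColouring G k) IsStrong

{-# OPTIONS --safe #-}
module Submission where

-- Colour the edges greedily, in the reverse of an elimination order of the vertices.  A set R of
-- remaining vertices carries a relation E: adjacency, or a link through eliminated vertices.  A
-- vertex v of R may be eliminated in two cases.
--   * v has at most two E-neighbours p and q.  Then every coloured edge in conflict with an edge
--     from v to an eliminated vertex meets p or q, and v itself contributes at most Δ ∸ 1 colours.
--     The vertex is suppressed: p and q become E-related.
--   * v has no neighbour of G in R.  Then an edge v y meets the at most Δ edges at the only other
--     vertex of R that y can reach, one edge beyond each other neighbour of v, and the edges at v.
-- In both cases fewer than 3Δ colours are forbidden.
-- One of the cases always applies.  By Menger's theorem, for an edge a b of a chordless graph a
-- single vertex separates a from b once the edge is removed, and elimination preserves this.  If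
-- every vertex of R had three E-neighbours and a G-neighbour in R, uncrossing these separations
-- would yield ever smaller sets of vertices whose boundary is a vertex and at most one edge.

open import Defs hiding (sym)
open import Data.Bool using (true; false; if_then_else_)
open import Data.Empty using (⊥; ⊥-elim)
open import Data.Fin using (Fin; zero; suc; toℕ; cast; _≟_) renaming (_<_ to _<ᶠ_)
open import Data.Fin.Properties using (any?; all?; ¬∀⟶∃¬; pigeonhole; toℕ<n; toℕ-cast; toℕ-injective) renaming (<⇒≢ to Fin-<⇒≢)
open import Data.Fin.Subset using (Subset; _∈_; _∉_; _⊆_; _⊂_; Nonempty; ⊤) renaming (⊥ to ∅)
open import Data.Fin.Subset.Induction using (⊂-wellFounded; Acc; acc)
open import Data.Fin.Subset.Properties using (_∈?_; nonempty?; ∈⊤; ∉⊥)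
open import Data.List using (List; []; _∷_; _++_; length; lookup; map; allFin; cartesianProduct; filter; foldr)
open import Data.List.Membership.DecPropositional using () renaming (_∈?_ to member?)
open import Data.List.Membership.Propositional using () renaming (_∈_ to _∈ˡ_; _∉_ to _∉ˡ_)
open import Data.List.Membership.Propositional.Properties using (∈-++⁻; ∈-++⁺ˡ; ∈-++⁺ʳ; ∈-filter⁺; ∈-filter⁻; ∈-allFin; ∈-cartesianProduct⁺; ∈-lookup; ∈-map⁺)
open import Data.List.Properties using (length-++; length-map; filter-notAll)
open import Data.List.Relation.Unary.All using ([]; _∷_) renaming (lookup to All-lookup; tabulate to All-tabulate)
open import Data.List.Relation.Unary.AllPairs using ([]; _∷_)
open import Data.List.Relation.Unary.Any using (here; there; index)
import Data.List.Relation.Unary.Any as Any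
open import Data.List.Relation.Unary.Any.Properties using (lookup-index)
open import Data.List.Relation.Unary.Unique.Propositional using (Unique)
open import Data.List.Relation.Unary.Unique.Propositional.Properties using (++⁺)
open import Data.Nat using (ℕ; zero; suc; _+_; _*_; _%_; _⊔_; _≤_; _<_; s≤s)
open import Data.Nat.DivMod using (m<n⇒m%n≡m; n%n≡0)
open import Data.Nat.ListAction using (sum)
open import Data.Nat.Properties using (suc-injective; m≤n⇒m<n∨m≡n; +-suc; m≤m+n; n≤1+n; ≤-trans; ≤-reflexive; <-≤-trans; +-mono-≤-<; +-identityʳ; m≤m⊔n; m≤n⊔m)
open import Data.Product using (∃; ∃₂; _×_; _,_; proj₁; proj₂; map₂)
open import Data.Sum as Sum using (_⊎_; inj₁; inj₂; [_,_]′)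
open import Data.Vec using (tabulate)
open import Data.Vec.Properties using (lookup∘tabulate; lookup⇒[]=; []=⇒lookup)
open import Function using (_∘_; id)
open import Relation.Binary using (Decidable; Symmetric)
open import Relation.Binary.PropositionalEquality using (_≡_; _≢_; refl; sym; trans; cong; subst; subst₂)
open import Relation.Nullary using (¬_; Dec; yes; no; does; ¬?; _×-dec_; _⊎-dec_; _→-dec_)
open import Relation.Nullary.Decidable using (dec-true; decidable-stable)
import Relation.Unary as U

-- Existence of a reduction

module _ {n : ℕ} where

  ⟦_⟧ : {P : Fin n → Set} → U.Decidable P → Subset n
  ⟦ P? ⟧ = tabulate (λ x → does (P? x))

  ∈⟦⟧⁺ : {P : Fin n → Set} (P? : U.Decidable P) → ∀ {x} → P x → x ∈ ⟦ P? ⟧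
  ∈⟦⟧⁺ P? {x} px = lookup⇒[]= x _ (trans (lookup∘tabulate _ x) (dec-true (P? x) px))

  ∈⟦⟧⁻ : {P : Fin n → Set} (P? : U.Decidable P) → ∀ {x} → x ∈ ⟦ P? ⟧ → P x
  ∈⟦⟧⁻ P? {x} x∈ with P? x | trans (sym (lookup∘tabulate (λ y → does (P? y)) x)) ([]=⇒lookup x∈)
  ... | yes px | _ = px
  ... | no _ | ()

  _∖_ : Subset n → Fin n → Subset n
  S ∖ v = ⟦ (λ x → (x ∈? S) ×-dec ¬? (x ≟ v)) ⟧

  ∈∖⁺ : ∀ {S v x} → x ∈ S → x ≢ v → x ∈ S ∖ v
  ∈∖⁺ {S} {v} x∈ x≢ = ∈⟦⟧⁺ (λ x → (x ∈? S) ×-dec ¬? (x ≟ v)) (x∈ , x≢)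

  ∈∖⁻ : ∀ {S v x} → x ∈ S ∖ v → x ∈ S × x ≢ v
  ∈∖⁻ {S} {v} = ∈⟦⟧⁻ (λ x → (x ∈? S) ×-dec ¬? (x ≟ v))

  ∖-⊂ : ∀ {S v} → v ∈ S → S ∖ v ⊂ S
  ∖-⊂ v∈S = proj₁ ∘ ∈∖⁻ , _ , v∈S , λ v∈ → proj₂ (∈∖⁻ v∈) refl

  Relates : (Fin n → Fin n → Set) → Subset n → Set
  Relates E S = ∀ {x y} → E x y → x ∈ S × y ∈ S

  -- With the edge a b removed, cut separates a from b; cut = a encodes that no cut vertex is needed.
  record Separation (E : Fin n → Fin n → Set) (a b : Fin n) : Set where
    constructor separation
    field
      side  : Subset n
      cut   : Fin n
      a∈    : a ∈ side
      b∉    : b ∉ side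
      cut≢b : cut ≢ b
      cross : ∀ {x y} → x ∈ side → y ∉ side → E x y → (x ≡ a × y ≡ b) ⊎ y ≡ cut

  Suppressible : (Fin n → Fin n → Set) → Fin n → Set
  Suppressible E v = ∃₂ λ p q → ∀ r → E v r → r ≡ p ⊎ r ≡ q

  -- `D` stands for adjacency in the graph, `E` for its enlargement by links through eliminated
  -- vertices. Separations are available for `D`-edges only, while exits are counted in `E`.
  Reducible : (E D : Fin n → Fin n → Set) → Subset n → Set
  Reducible E D R = ∃ λ v → v ∈ R × (Suppressible E v ⊎ (∀ r → r ∈ R → ¬ D v r))

  module _ {E D : Fin n → Fin n → Set} {R : Subset n}
           (E? : Decidable E) (D? : Decidable D)
           (E-sym : Symmetric E) (E-irr : ∀ {x} → ¬ E x x)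
           (E⊆R : Relates E R)
           (D⊆E : ∀ {x y} → x ∈ R → y ∈ R → D x y → E x y)
           (separate : ∀ {a b} → a ∈ R → b ∈ R → D a b → Separation E a b)
           where

    private
      -- The attachments c, w, v of a piece need not exist: a piece with fewer exits names arbitrary vertices.
      EndPiece : Subset n → Fin n → Set
      EndPiece U c = ∀ {x y} → x ∈ U → y ∉ U → E x y → y ≡ c

      Piece : Subset n → Fin n → Fin n → Fin n → Set
      Piece A w v c = ∀ {x y} → x ∈ A → y ∉ A → E x y → y ≡ c ⊎ (x ≡ v × y ≡ w)

      module Irreducible (¬red : ¬ Reducible E D R) where

        third : ∀ {v} → v ∈ R → ∀ p q → ∃ λ r → E v r × r ≢ p × r ≢ q
        third {v} v∈R p q
          with ¬∀⟶∃¬ n (λ r → E v r → r ≡ p ⊎ r ≡ q)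
                 (λ r → E? v r →-dec ((r ≟ p) ⊎-dec (r ≟ q)))
                 (λ h → ¬red (v , v∈R , inj₁ (p , q , h)))
        ... | r , ¬h = r , decidable-stable (E? v r) (λ ¬e → ¬h (λ e → ⊥-elim (¬e e)))
                         , (λ r≡p → ¬h (λ _ → inj₁ r≡p))
                         , (λ r≡q → ¬h (λ _ → inj₂ r≡q))

        direct : ∀ {v} → v ∈ R → ∃ λ r → r ∈ R × D v r
        direct {v} v∈R with any? (λ r → (r ∈? R) ×-dec D? v r)
        ... | yes h = h
        ... | no ¬h = ⊥-elim (¬red (v , v∈R , inj₂ (λ r r∈ d → ¬h (r , r∈ , d))))

        Smaller : Subset n → Set
        Smaller U = ∃₂ λ U′ c → U′ ⊂ U × Nonempty U′ × EndPiece U′ c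

        -- The edge v w is a bridge, so one of its sides contains a smaller end piece.
        bridge : ∀ {U c₀ v u w} {W : Subset n} → EndPiece U c₀ →
                 v ∈ U → u ∈ U → u ≢ v → E v w → w ∈ W → v ∉ W →
                 (∀ {x y} → x ∈ W → y ∉ W → E x y → x ≡ w × y ≡ v) → Smaller U
        -- The part of `U` that lies across the bridge from `c₀` has the bridge as its only exit.
        bridge {U} {c₀} {v} {u} {w} {W} end v∈U u∈U u≢v vw w∈W v∉W leave with c₀ ∈? W
        ... | no c₀∉W = U∩W , v , (proj₁ ∘ back , v , v∈U , v∉W ∘ proj₂ ∘ back) , (w , fwd w∈U w∈W) , end′
          where
          U∩W = ⟦ (λ x → (x ∈? U) ×-dec (x ∈? W)) ⟧
          fwd : ∀ {x} → x ∈ U → x ∈ W → x ∈ U∩W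
          fwd x∈U x∈W = ∈⟦⟧⁺ (λ x → (x ∈? U) ×-dec (x ∈? W)) (x∈U , x∈W)
          back : ∀ {x} → x ∈ U∩W → x ∈ U × x ∈ W
          back = ∈⟦⟧⁻ (λ x → (x ∈? U) ×-dec (x ∈? W))
          w∈U : w ∈ U
          w∈U with w ∈? U
          ... | yes p = p
          ... | no w∉U = ⊥-elim (c₀∉W (subst (_∈ W) (end v∈U w∉U vw) w∈W))
          end′ : EndPiece U∩W v
          end′ {x} {y} x∈ y∉ xy with y ∈? W
          ... | no y∉W = proj₂ (leave (proj₂ (back x∈)) y∉W xy)
          ... | yes y∈W with y ∈? U
          ...   | yes y∈U = ⊥-elim (y∉ (fwd y∈U y∈W))
          ...   | no y∉U = ⊥-elim (c₀∉W (subst (_∈ W) (end (proj₁ (back x∈)) y∉U xy) y∈W))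
        ... | yes c₀∈W with any? (λ x → (x ∈? U) ×-dec (x ∈? W))
        ...   | yes (z , z∈U , z∈W) =
                U─W , w , (proj₁ ∘ back , z , z∈U , λ z∈ → proj₂ (back z∈) z∈W) , (v , fwd v∈U v∉W) , end′
          where
          U─W = ⟦ (λ x → (x ∈? U) ×-dec ¬? (x ∈? W)) ⟧
          fwd : ∀ {x} → x ∈ U → x ∉ W → x ∈ U─W
          fwd x∈U x∉W = ∈⟦⟧⁺ (λ x → (x ∈? U) ×-dec ¬? (x ∈? W)) (x∈U , x∉W)
          back : ∀ {x} → x ∈ U─W → x ∈ U × x ∉ W
          back = ∈⟦⟧⁻ (λ x → (x ∈? U) ×-dec ¬? (x ∈? W))
          end′ : EndPiece U─W w
          end′ {x} {y} x∈ y∉ xy with y ∈? W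
          ... | yes y∈W = proj₁ (leave y∈W (proj₂ (back x∈)) (E-sym xy))
          ... | no y∉W with y ∈? U
          ...   | yes y∈U = ⊥-elim (y∉ (fwd y∈U y∉W))
          ...   | no y∉U = ⊥-elim (y∉W (subst (_∈ W) (sym (end (proj₁ (back x∈)) y∉U xy)) c₀∈W))
        -- Here that part is all of `U`, which is not smaller. But then `w` is `c₀`, and only `v`
        -- has an edge to it, so deleting `v` leaves a piece with exit `v`.
        ...   | no disj = U ∖ v , v , ∖-⊂ v∈U , (u , ∈∖⁺ u∈U u≢v) , end′
          where
          ∉W : ∀ {x} → x ∈ U → x ∉ W
          ∉W x∈U x∈W = disj (_ , x∈U , x∈W)
          w≡c₀ : w ≡ c₀
          w≡c₀ = end v∈U (λ w∈U → ∉W w∈U w∈W) vw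
          end′ : EndPiece (U ∖ v) v
          end′ {x} {y} x∈ y∉ xy with y ≟ v
          ... | yes y≡v = y≡v
          ... | no y≢v with y ∈? U
          ...   | yes y∈U = ⊥-elim (y∉ (∈∖⁺ y∈U y≢v))
          ...   | no y∉U = ⊥-elim (proj₂ (∈∖⁻ x∈) (proj₂ (leave (subst (_∈ W) (trans w≡c₀ (sym (end x∈U y∉U xy))) w∈W)
                                                        (∉W x∈U) (E-sym xy))))
            where x∈U = proj₁ (∈∖⁻ x∈)

        Shrunk : Subset n → Subset n → Set
        Shrunk U A = (∃ λ A′ → A′ ⊂ A × Nonempty A′ × ∃ λ w → ∃₂ (Piece A′ w)) ⊎ Smaller U

        -- Of the two parts into which the separation splits A, one inherits few enough exits, unless
        -- v w and c leave on different sides; then v w is a bridge.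
        uncross : ∀ {U c₀ A w v c a b} → EndPiece U c₀ → A ⊆ U → Piece A w v c →
                  a ∈ A → b ∈ A → Separation E a b → Shrunk U A
        uncross {U} {c₀} {A} {w} {v} {c} {a} {b} end A⊆U piece a∈A b∈A (separation X c′ a∈X b∉X c′≢b cross) = result
          where
          P₁? : U.Decidable (λ x → x ∈ A × x ∈ X)
          P₁? x = (x ∈? A) ×-dec (x ∈? X)
          -- `c′` may receive any number of edges from `X`; leaving it out of the second part turns
          -- it into a single exit vertex.
          P₂? : U.Decidable (λ x → x ∈ A × x ∉ X × x ≢ c′)
          P₂? x = (x ∈? A) ×-dec (¬? (x ∈? X) ×-dec ¬? (x ≟ c′))
          A₁ = ⟦ P₁? ⟧
          A₂ = ⟦ P₂? ⟧

          cross′ : ∀ {x y} → x ∈ X → y ∉ X → E y x → (x ≡ a × y ≡ b) ⊎ y ≡ c′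
          cross′ x∈ y∉ yx = cross x∈ y∉ (E-sym yx)

          Out : Fin n → Fin n → Set
          Out x y = y ∉ A × (y ≡ c ⊎ (x ≡ v × y ≡ w))

          leave₁ : ∀ {x y} → x ∈ A₁ → y ∉ A₁ → E x y →
                   (x ≡ a × y ≡ b) ⊎ (y ≡ c′ × c′ ∈ A) ⊎ Out x y
          leave₁ {x} {y} x∈ y∉ xy with ∈⟦⟧⁻ P₁? x∈ | y ∈? A
          ... | x∈A , x∈X | no y∉A = inj₂ (inj₂ (y∉A , piece x∈A y∉A xy))
          ... | x∈A , x∈X | yes y∈A with cross x∈X (λ y∈X → y∉ (∈⟦⟧⁺ P₁? (y∈A , y∈X))) xy
          ...   | inj₁ h = inj₁ h
          ...   | inj₂ refl = inj₂ (inj₁ (refl , y∈A))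

          leave₂ : ∀ {x y} → x ∈ A₂ → y ∉ A₂ → E x y →
                   (x ≡ b × y ≡ a) ⊎ (y ≡ c′ × c′ ∈ A) ⊎ Out x y
          leave₂ {x} {y} x∈ y∉ xy with ∈⟦⟧⁻ P₂? x∈ | y ∈? A
          ... | x∈A , x∉X , x≢c′ | no y∉A = inj₂ (inj₂ (y∉A , piece x∈A y∉A xy))
          ... | x∈A , x∉X , x≢c′ | yes y∈A with y ∈? X | y ≟ c′
          ...   | _ | yes refl = inj₂ (inj₁ (refl , y∈A))
          ...   | no y∉X | no y≢c′ = ⊥-elim (y∉ (∈⟦⟧⁺ P₂? (y∈A , y∉X , y≢c′)))
          ...   | yes y∈X | no _ with cross′ y∈X x∉X xy
          ...     | inj₁ (y≡a , x≡b) = inj₁ (x≡b , y≡a)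
          ...     | inj₂ x≡c′ = ⊥-elim (x≢c′ x≡c′)

          take₁ : ∀ {w v c} → Piece A₁ w v c → Shrunk U A
          take₁ p = inj₁ (A₁ , (proj₁ ∘ ∈⟦⟧⁻ P₁? , b , b∈A , b∉X ∘ proj₂ ∘ ∈⟦⟧⁻ P₁?)
                            , (a , ∈⟦⟧⁺ P₁? (a∈A , a∈X)) , _ , _ , _ , p)

          take₂ : ∀ {w v c} → Piece A₂ w v c → Shrunk U A
          take₂ p = inj₁ (A₂ , (proj₁ ∘ ∈⟦⟧⁻ P₂? , a , a∈A , λ a∈ → proj₁ (proj₂ (∈⟦⟧⁻ P₂? a∈)) a∈X)
                            , (b , ∈⟦⟧⁺ P₂? (b∈A , b∉X , c′≢b ∘ sym)) , _ , _ , _ , p)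

          Attached : Subset n → Set
          Attached S = v ∈ S × E v w × w ∉ A

          attached? : ∀ S → Dec (Attached S)
          attached? S = (v ∈? S) ×-dec (E? v w ×-dec ¬? (w ∈? A))

          -- Read backwards, such an edge would leave `X`. It starts at `c`, which is outside `A`
          -- and so not `a`, and it does not end in `c′`, which `A₂` omits.
          ∉A₂-out : ∀ {x y} → c ∈ X → x ∈ A₂ → y ∉ A → y ≡ c → ¬ E x y
          ∉A₂-out c∈X x∈ y∉A refl xy with ∈⟦⟧⁻ P₂? x∈
          ... | x∈A , x∉X , x≢c′ with cross′ c∈X x∉X xy
          ...   | inj₁ (refl , _) = y∉A a∈A
          ...   | inj₂ x≡c′ = x≢c′ x≡c′

          ∉A₁-out : ∀ {x y} → c ∉ X → c ≢ c′ → x ∈ A₁ → y ∉ A → y ≡ c → ¬ E x y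
          ∉A₁-out c∉X c≢c′ x∈ y∉A refl xy with cross (proj₂ (∈⟦⟧⁻ P₁? x∈)) c∉X xy
          ... | inj₁ (_ , refl) = y∉A b∈A
          ... | inj₂ c≡c′ = c≢c′ c≡c′

          -- The second part cannot exit to `c`, which leaves `a b`, `c′` and `v w`. Without `v w`
          -- or without `c′`, the other two form the boundary of a piece; in the latter case `a`
          -- becomes the exit vertex. With both present, `v w` is a bridge.
          case-c∈X : c ∈ X → Shrunk U A
          case-c∈X c∈X with attached? A₂ | c′ ∈? A
          ... | no ¬att | _ = take₂ piece₂
            where
            piece₂ : Piece A₂ a b c′
            piece₂ x∈ y∉ xy with leave₂ x∈ y∉ xy
            ... | inj₁ h = inj₂ h
            ... | inj₂ (inj₁ (y≡c′ , _)) = inj₁ y≡c′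
            ... | inj₂ (inj₂ (y∉A , inj₁ y≡c)) = ⊥-elim (∉A₂-out c∈X x∈ y∉A y≡c xy)
            ... | inj₂ (inj₂ (y∉A , inj₂ (refl , refl))) = ⊥-elim (¬att (x∈ , xy , y∉A))
          ... | yes _ | no c′∉A = take₂ piece₂
            where
            piece₂ : Piece A₂ w v a
            piece₂ x∈ y∉ xy with leave₂ x∈ y∉ xy
            ... | inj₁ (_ , y≡a) = inj₁ y≡a
            ... | inj₂ (inj₁ (_ , c′∈A)) = ⊥-elim (c′∉A c′∈A)
            ... | inj₂ (inj₂ (y∉A , inj₁ y≡c)) = ⊥-elim (∉A₂-out c∈X x∈ y∉A y≡c xy)
            ... | inj₂ (inj₂ (y∉A , inj₂ h)) = inj₂ h
          ... | yes (v∈A₂ , vw , w∉A) | yes c′∈A with ∈⟦⟧⁻ P₂? v∈A₂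
          ...   | v∈A , v∉X , v≢c′ =
                  -- The far side is everything outside `X` and `A`. As `b` and `c′` lie in `A` and
                  -- `c` in `X`, only `v w` joins it to the rest.
                  inj₂ (bridge end (A⊆U v∈A) (A⊆U a∈A) (λ { refl → v∉X a∈X }) vw
                         (∈⟦⟧⁺ W? (w∉X , w∉A)) (λ v∈W → proj₂ (∈⟦⟧⁻ W? v∈W) v∈A) leave)
            where
            W? : U.Decidable (λ x → x ∉ X × x ∉ A)
            W? x = ¬? (x ∈? X) ×-dec ¬? (x ∈? A)
            w∉X : w ∉ X
            w∉X w∈X with cross′ w∈X v∉X vw
            ... | inj₁ (refl , _) = w∉A a∈A
            ... | inj₂ v≡c′ = v≢c′ v≡c′
            leave : ∀ {x y} → x ∈ ⟦ W? ⟧ → y ∉ ⟦ W? ⟧ → E x y → x ≡ w × y ≡ v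
            leave {x} {y} x∈ y∉ xy with ∈⟦⟧⁻ W? x∈ | y ∈? X | y ∈? A
            ... | x∉X , x∉A | no y∉X | no y∉A = ⊥-elim (y∉ (∈⟦⟧⁺ W? (y∉X , y∉A)))
            ... | x∉X , x∉A | yes y∈X | _ with cross′ y∈X x∉X xy
            ...   | inj₁ (_ , refl) = ⊥-elim (x∉A b∈A)
            ...   | inj₂ refl = ⊥-elim (x∉A c′∈A)
            leave {x} {y} x∈ y∉ xy | x∉X , x∉A | no y∉X | yes y∈A with piece y∈A x∉A (E-sym xy)
            ...   | inj₁ refl = ⊥-elim (x∉X c∈X)
            ...   | inj₂ (y≡v , x≡w) = x≡w , y≡v

          -- Mirror image with the first part; the far side of the bridge is now `X` minus `A`.
          -- Since `c` is not `c′`, no vertex of the first part has an edge to it.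
          case-c∉X : c ∉ X → c ≢ c′ → Shrunk U A
          case-c∉X c∉X c≢c′ with attached? A₁ | c′ ∈? A
          ... | no ¬att | _ = take₁ piece₁
            where
            piece₁ : Piece A₁ b a c′
            piece₁ x∈ y∉ xy with leave₁ x∈ y∉ xy
            ... | inj₁ h = inj₂ h
            ... | inj₂ (inj₁ (y≡c′ , _)) = inj₁ y≡c′
            ... | inj₂ (inj₂ (y∉A , inj₁ y≡c)) = ⊥-elim (∉A₁-out c∉X c≢c′ x∈ y∉A y≡c xy)
            ... | inj₂ (inj₂ (y∉A , inj₂ (refl , refl))) = ⊥-elim (¬att (x∈ , xy , y∉A))
          ... | yes _ | no c′∉A = take₁ piece₁
            where
            piece₁ : Piece A₁ w v b
            piece₁ x∈ y∉ xy with leave₁ x∈ y∉ xy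
            ... | inj₁ (_ , y≡b) = inj₁ y≡b
            ... | inj₂ (inj₁ (_ , c′∈A)) = ⊥-elim (c′∉A c′∈A)
            ... | inj₂ (inj₂ (y∉A , inj₁ y≡c)) = ⊥-elim (∉A₁-out c∉X c≢c′ x∈ y∉A y≡c xy)
            ... | inj₂ (inj₂ (y∉A , inj₂ h)) = inj₂ h
          ... | yes (v∈A₁ , vw , w∉A) | yes c′∈A with ∈⟦⟧⁻ P₁? v∈A₁
          ...   | v∈A , v∈X =
                  inj₂ (bridge end (A⊆U v∈A) (A⊆U b∈A) (λ { refl → b∉X v∈X }) vw
                         (∈⟦⟧⁺ W? (w∈X , w∉A)) (λ v∈W → proj₂ (∈⟦⟧⁻ W? v∈W) v∈A) leave)
            where
            W? : U.Decidable (λ x → x ∈ X × x ∉ A)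
            W? x = (x ∈? X) ×-dec ¬? (x ∈? A)
            w∈X : w ∈ X
            w∈X = decidable-stable (w ∈? X) λ w∉X →
              [ (λ { (_ , refl) → w∉A b∈A }) , (λ { refl → w∉A c′∈A }) ]′ (cross v∈X w∉X vw)
            leave : ∀ {x y} → x ∈ ⟦ W? ⟧ → y ∉ ⟦ W? ⟧ → E x y → x ≡ w × y ≡ v
            leave {x} {y} x∈ y∉ xy with ∈⟦⟧⁻ W? x∈ | y ∈? A
            ... | x∈X , x∉A | yes y∈A with piece y∈A x∉A (E-sym xy)
            ...   | inj₁ refl = ⊥-elim (c∉X x∈X)
            ...   | inj₂ (y≡v , x≡w) = x≡w , y≡v
            leave {x} {y} x∈ y∉ xy | x∈X , x∉A | no y∉A
              with cross x∈X (λ y∈X → y∉ (∈⟦⟧⁺ W? (y∈X , y∉A))) xy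
            ... | inj₁ (refl , _) = ⊥-elim (x∉A a∈A)
            ... | inj₂ refl = ⊥-elim (y∉A c′∈A)

          -- `c` and `c′` count as one exit, so the part that does not contain `v` has only this
          -- exit and the edge `a b`.
          case-c≡c′ : c ≡ c′ → Shrunk U A
          case-c≡c′ refl with v ∈? X
          ... | yes v∈X = take₂ piece₂
            where
            piece₂ : Piece A₂ a b c
            piece₂ x∈ y∉ xy with leave₂ x∈ y∉ xy
            ... | inj₁ h = inj₂ h
            ... | inj₂ (inj₁ (y≡c , _)) = inj₁ y≡c
            ... | inj₂ (inj₂ (y∉A , inj₁ y≡c)) = inj₁ y≡c
            ... | inj₂ (inj₂ (y∉A , inj₂ (refl , _))) = ⊥-elim (proj₁ (proj₂ (∈⟦⟧⁻ P₂? x∈)) v∈X)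
          ... | no v∉X = take₁ piece₁
            where
            piece₁ : Piece A₁ b a c
            piece₁ x∈ y∉ xy with leave₁ x∈ y∉ xy
            ... | inj₁ h = inj₂ h
            ... | inj₂ (inj₁ (y≡c , _)) = inj₁ y≡c
            ... | inj₂ (inj₂ (y∉A , inj₁ y≡c)) = inj₁ y≡c
            ... | inj₂ (inj₂ (y∉A , inj₂ (refl , _))) = ⊥-elim (v∉X (proj₂ (∈⟦⟧⁻ P₁? x∈)))

          result : Shrunk U A
          result with c ∈? X | c ≟ c′
          ... | yes c∈X | _ = case-c∈X c∈X
          ... | no _ | yes c≡c′ = case-c≡c′ c≡c′
          ... | no c∉X | no c≢c′ = case-c∉X c∉X c≢c′

        -- If no direct edge lies inside the piece A, every vertex of A other than v is joined to c by one.
        -- Separating z from c then forces exactly two further neighbours of z: v and one mate.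
        record Corner (A : Subset n) (v c z : Fin n) : Set where
          field
            sep     : Separation E z c
          open Separation sep public
          field
            mate∈   : cut ∈ A
            mate≢v  : cut ≢ v
            mate∉   : cut ∉ side
            toMate  : E z cut
            toV     : E z v
            v∈A     : v ∈ A
            v∈side  : v ∈ side
            nbrs    : ∀ {r} → E z r → r ≡ c ⊎ r ≡ cut ⊎ r ≡ v

        -- A neighbour of `z` in `A` other than `v` is joined to `c`, so it cannot lie on the side
        -- of `z`; hence it is the cut vertex. Having three neighbours, `z` must be joined to both
        -- the cut vertex and `v`.
        corner : ∀ {A w v c z} → A ⊆ R → Piece A w v c → c ∉ A →
                 (∀ {r} → r ∈ A → r ≢ v → E r c) → z ∈ A → z ≢ v → Separation E z c → Corner A v c z
        corner {A} {w} {v} {c} {z} A⊆R piece c∉A edgeC z∈A z≢v s = record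
          { sep = s ; mate∈ = subst (_∈ A) y≡cut y∈A ; mate≢v = λ cut≡v → y≢v (trans y≡cut cut≡v)
          ; mate∉ = λ cut∈ → far y∈A y≢v zy (subst (_∈ side) (sym y≡cut) cut∈)
          ; toMate = subst (E z) y≡cut zy ; toV = zv ; v∈A = inside zv v≢c ; v∈side = v∈s ; nbrs = nb }
          where
          open Separation s
          ≢c : ∀ {r} → r ∈ A → r ≢ c
          ≢c r∈A refl = c∉A r∈A
          inside : ∀ {r} → E z r → r ≢ c → r ∈ A
          inside {r} zr r≢c with r ∈? A
          ... | yes r∈A = r∈A
          ... | no r∉A with piece z∈A r∉A zr
          ...   | inj₁ r≡c = ⊥-elim (r≢c r≡c)
          ...   | inj₂ (z≡v , _) = ⊥-elim (z≢v z≡v)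
          far : ∀ {r} → r ∈ A → r ≢ v → E z r → r ∉ side
          far r∈A r≢v zr r∈ with cross r∈ b∉ (edgeC r∈A r≢v)
          ... | inj₁ (refl , _) = E-irr zr
          ... | inj₂ c≡cut = cut≢b (sym c≡cut)
          isCut : ∀ {r} → r ∈ A → r ≢ v → E z r → r ≡ cut
          isCut r∈A r≢v zr with cross a∈ (far r∈A r≢v zr) zr
          ... | inj₁ (_ , r≡c) = ⊥-elim (≢c r∈A r≡c)
          ... | inj₂ r≡cut = r≡cut
          y-data = third (A⊆R z∈A) c v
          y = proj₁ y-data
          zy = proj₁ (proj₂ y-data)
          y≢v = proj₂ (proj₂ (proj₂ y-data))
          y∈A = inside zy (proj₁ (proj₂ (proj₂ y-data)))
          y≡cut = isCut y∈A y≢v zy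
          r-data = third (A⊆R z∈A) c y
          r = proj₁ r-data
          zr = proj₁ (proj₂ r-data)
          r∈A = inside zr (proj₁ (proj₂ (proj₂ r-data)))
          r≡v : r ≡ v
          r≡v = decidable-stable (r ≟ v) λ r≢v →
            proj₂ (proj₂ (proj₂ r-data)) (trans (isCut r∈A r≢v zr) (sym y≡cut))
          zv : E z v
          zv = subst (E z) r≡v zr
          v≢c : v ≢ c
          v≢c v≡c = ≢c r∈A (trans r≡v v≡c)
          v∈s : v ∈ side
          v∈s = decidable-stable (v ∈? side) λ v∉ →
            [ v≢c ∘ proj₂ , (λ v≡cut → y≢v (trans y≡cut (sym v≡cut))) ]′ (cross a∈ v∉ zv)
          nb : ∀ {r} → E z r → r ≡ c ⊎ r ≡ cut ⊎ r ≡ v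
          nb {r} zr with r ≟ c | r ≟ v
          ... | yes r≡c | _ = inj₁ r≡c
          ... | no _ | yes r≡v = inj₂ (inj₂ r≡v)
          ... | no r≢c | no r≢v = inj₂ (inj₁ (isCut (inside zr r≢c) r≢v zr))

        -- Here A = {v, x, mate of x}, and the separation of x from c shows that v w is a bridge.
        diamond : ∀ {U c₀ A w v c x} → EndPiece U c₀ → A ⊆ U → A ⊆ R → Piece A w v c → c ∉ A →
                  (∀ {r} → r ∈ A → r ≢ v → E r c) → (∀ {r} → r ∈ A → r ≢ v → E r v) →
                  x ∈ A → x ≢ v → (X : Corner A v c x) → Corner A v c (Corner.cut X) → Smaller U
        diamond {U} {c₀} {A} {w} {v} {c} {x} end A⊆U A⊆R piece c∉A edgeC edgeV x∈A x≢v X Y =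
          bridge end (A⊆U v∈A) (A⊆U x∈A) x≢v (proj₁ exit)
            (∈⟦⟧⁺ W? (w∈side , (λ { refl → proj₂ exit x∈A }) , (λ { refl → proj₂ exit v∈A })))
            (λ v∈W → proj₂ (proj₂ (∈⟦⟧⁻ W? v∈W)) refl) leave
          where
          open Corner X
          ≢c : ∀ {r} → r ∈ A → r ≢ c
          ≢c r∈A refl = c∉A r∈A

          -- A fourth vertex would be joined to `v`, inside `side`, and to `c`, outside it, so one
          -- of these two edges would cross the separation illegally.
          only : ∀ {z} → z ∈ A → z ≡ v ⊎ z ≡ x ⊎ z ≡ cut
          only {z} z∈A with z ≟ v | z ≟ x | z ≟ cut
          ... | yes p | _ | _ = inj₁ p
          ... | no _ | yes p | _ = inj₂ (inj₁ p)
          ... | no _ | no _ | yes p = inj₂ (inj₂ p)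
          ... | no z≢v | no z≢x | no z≢cut = ⊥-elim (bad (z ∈? side))
            where
            bad : Dec (z ∈ side) → ⊥
            bad (yes z∈) = [ z≢x ∘ proj₁ , cut≢b ∘ sym ]′ (cross z∈ b∉ (edgeC z∈A z≢v))
            bad (no z∉) = [ ≢c z∈A ∘ proj₂ , z≢cut ]′ (cross v∈side z∉ (E-sym (edgeV z∈A z≢v)))

          -- `x` is a neighbour of its mate and is neither `c` nor `v`, so it is the mate of its
          -- mate.
          mateNbrs : ∀ {r} → E cut r → r ≡ c ⊎ r ≡ x ⊎ r ≡ v
          mateNbrs cr with Corner.nbrs Y cr | Corner.nbrs Y (E-sym toMate)
          ... | inj₁ h | _ = inj₁ h
          ... | inj₂ (inj₂ h) | _ = inj₂ (inj₂ h)
          ... | inj₂ (inj₁ h) | inj₁ x≡c = ⊥-elim (≢c x∈A x≡c)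
          ... | inj₂ (inj₁ h) | inj₂ (inj₂ x≡v) = ⊥-elim (x≢v x≡v)
          ... | inj₂ (inj₁ h) | inj₂ (inj₁ x≡m) = inj₂ (inj₁ (trans h (sym x≡m)))

          v≁c : ∀ {r} → E v r → r ≢ c
          v≁c vr refl = [ x≢v ∘ sym ∘ proj₁ , cut≢b ∘ sym ]′ (cross v∈side b∉ vr)

          exit : E v w × w ∉ A
          exit with third (A⊆R v∈A) x cut
          ... | r , vr , r≢x , r≢cut with r ∈? A
          ...   | yes r∈A = ⊥-elim ([ (λ { refl → E-irr vr }) , [ r≢x , r≢cut ]′ ]′ (only r∈A))
          ...   | no r∉A with piece v∈A r∉A vr
          ...     | inj₁ r≡c = ⊥-elim (v≁c vr r≡c)
          ...     | inj₂ (_ , refl) = vr , r∉A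

          w∈side : w ∈ side
          w∈side = decidable-stable (w ∈? side) λ w∉ →
            [ v≁c (proj₁ exit) ∘ proj₂ , (λ w≡cut → proj₂ exit (subst (_∈ A) (sym w≡cut) mate∈)) ]′
              (cross v∈side w∉ (proj₁ exit))

          -- Beyond `v`, nothing is joined to this set except through `x` or the mate, and their
          -- neighbourhoods are known: `c`, `v` and each other, none of them in the set.
          W? : U.Decidable (λ z → z ∈ side × z ≢ x × z ≢ v)
          W? z = (z ∈? side) ×-dec (¬? (z ≟ x) ×-dec ¬? (z ≟ v))

          c∉side : ∀ {p} → p ∈ side → p ≢ c
          c∉side p∈ refl = b∉ p∈

          cut∉side : ∀ {p} → p ∈ side → p ≢ cut
          cut∉side p∈ p≡cut = mate∉ (subst (_∈ side) p≡cut p∈)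

          leave : ∀ {p q} → p ∈ ⟦ W? ⟧ → q ∉ ⟦ W? ⟧ → E p q → p ≡ w × q ≡ v
          leave {p} {q} p∈ q∉ pq with ∈⟦⟧⁻ W? p∈ | q ≟ v | q ≟ x
          ... | p∈s , p≢x , p≢v | yes refl | _ with p ∈? A
          ...   | yes p∈A = ⊥-elim ([ p≢v , [ p≢x , cut∉side p∈s ]′ ]′ (only p∈A))
          ...   | no p∉A with piece v∈A p∉A (E-sym pq)
          ...     | inj₁ p≡c = ⊥-elim (c∉side p∈s p≡c)
          ...     | inj₂ (_ , p≡w) = p≡w , refl
          leave {p} {q} p∈ q∉ pq | p∈s , p≢x , p≢v | no _ | yes refl =
            ⊥-elim ([ c∉side p∈s , [ cut∉side p∈s , p≢v ]′ ]′ (nbrs (E-sym pq)))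
          leave {p} {q} p∈ q∉ pq | p∈s , p≢x , p≢v | no q≢v | no q≢x
            with cross p∈s (λ q∈s → q∉ (∈⟦⟧⁺ W? (q∈s , q≢x , q≢v))) pq
          ... | inj₁ (p≡x , _) = ⊥-elim (p≢x p≡x)
          ... | inj₂ q≡cut =
                ⊥-elim ([ c∉side p∈s , [ p≢x , p≢v ]′ ]′ (mateNbrs (subst (λ q → E q p) q≡cut (E-sym pq))))

        -- Every vertex of `A` other than `v` has a direct neighbour, which lies outside `A` and
        -- must then be `c`. These direct edges supply the separations that make every such vertex a
        -- corner.
        independent : ∀ {U c₀ A w v c x} → EndPiece U c₀ → A ⊆ U → U ⊆ R → Piece A w v c →
                      (∀ {a b} → a ∈ A → b ∈ A → ¬ D a b) → x ∈ A → x ≢ v → Smaller U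
        independent {U} {c₀} {A} {w} {v} {c} {x} end A⊆U U⊆R piece indep x∈A x≢v =
          diamond end A⊆U A⊆R piece c∉A edgeC (λ r∈ r≢v → Corner.toV (at r∈ r≢v)) x∈A x≢v
            (at x∈A x≢v) (at (Corner.mate∈ (at x∈A x≢v)) (Corner.mate≢v (at x∈A x≢v)))
          where
          A⊆R : A ⊆ R
          A⊆R z∈ = U⊆R (A⊆U z∈)

          toC : ∀ {z} → z ∈ A → z ≢ v → c ∈ R × c ∉ A × D z c
          toC z∈A z≢v with direct (A⊆R z∈A)
          ... | r , r∈R , zr with piece z∈A (λ r∈A → indep z∈A r∈A zr) (D⊆E (A⊆R z∈A) r∈R zr)
          ...   | inj₁ refl = r∈R , (λ r∈A → indep z∈A r∈A zr) , zr
          ...   | inj₂ (z≡v , _) = ⊥-elim (z≢v z≡v)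

          c∉A : c ∉ A
          c∉A = proj₁ (proj₂ (toC x∈A x≢v))

          edgeC : ∀ {z} → z ∈ A → z ≢ v → E z c
          edgeC z∈A z≢v with toC z∈A z≢v
          ... | c∈R , _ , zc = D⊆E (A⊆R z∈A) c∈R zc

          at : ∀ {z} → z ∈ A → z ≢ v → Corner A v c z
          at z∈A z≢v with toC z∈A z≢v
          ... | c∈R , _ , zc = corner A⊆R piece c∉A edgeC z∈A z≢v (separate (A⊆R z∈A) c∈R zc)

        -- Uncrossing at direct edges inside the piece shrinks it until a bridge appears or no
        -- direct edge is left inside.
        shrinkPiece : ∀ {U c₀ A w v c} → Acc _⊂_ A → EndPiece U c₀ → U ⊆ R → A ⊆ U →
                      Nonempty A → Piece A w v c → Smaller U
        shrinkPiece {U} {c₀} {A} {w} {v} {c} (acc rec) end U⊆R A⊆U (a₀ , a₀∈A) piece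
          with any? (λ a → any? (λ b → (a ∈? A) ×-dec ((b ∈? A) ×-dec D? a b)))
        ... | yes (a , b , a∈A , b∈A , ab)
            with uncross end A⊆U piece a∈A b∈A (separate (U⊆R (A⊆U a∈A)) (U⊆R (A⊆U b∈A)) ab)
        ...   | inj₂ smaller = smaller
        ...   | inj₁ (A′ , A′⊂A , ne , w′ , v′ , c′ , piece′) =
                shrinkPiece (rec A′⊂A) end U⊆R (A⊆U ∘ proj₁ A′⊂A) ne piece′
        shrinkPiece {U} {c₀} {A} {w} {v} {c} (acc rec) end U⊆R A⊆U (a₀ , a₀∈A) piece | no indep with a₀ ≟ v
        ... | no a₀≢v = independent end A⊆U U⊆R piece (λ a∈ b∈ ab → indep (_ , _ , a∈ , b∈ , ab)) a₀∈A a₀≢v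
        -- A vertex other than `v` is wanted: a neighbour of `v` that avoids both possible exits
        -- stays inside `A`.
        ... | yes refl with third (U⊆R (A⊆U a₀∈A)) w c
        ...   | r , vr , r≢w , r≢c with r ∈? A
        ...     | yes r∈A = independent end A⊆U U⊆R piece (λ a∈ b∈ ab → indep (_ , _ , a∈ , b∈ , ab)) r∈A
                              (λ { refl → E-irr vr })
        ...     | no r∉A = ⊥-elim ([ r≢c , r≢w ∘ proj₂ ]′ (piece a₀∈A r∉A vr))

        -- Infinite descent. An end piece is regarded as a piece with a degenerate exit edge, both
        -- ends being set to `c₀`.
        impossible : ∀ {U c₀} → Acc _⊂_ U → U ⊆ R → Nonempty U → EndPiece U c₀ → ⊥
        impossible {U} {c₀} (acc rec) U⊆R ne end
          with shrinkPiece {w = c₀} {v = c₀} (⊂-wellFounded U) end U⊆R id ne (λ x∈ y∉ xy → inj₁ (end x∈ y∉ xy))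
        ... | U′ , c′ , U′⊂U , ne′ , end′ = impossible (rec U′⊂U) (U⊆R ∘ proj₁ U′⊂U) ne′ end′

    reducible : Nonempty R → Reducible E D R
    reducible ne@(r₀ , _) = decidable-stable reducible? λ ¬red →
      -- `R` has no exits at all, so any vertex can be named as its exit.
      Irreducible.impossible ¬red {c₀ = r₀} (⊂-wellFounded R) id ne (λ x∈ y∉ xy → ⊥-elim (y∉ (proj₂ (E⊆R xy))))
      where
      reducible? : Dec (Reducible E D R)
      reducible? = any? λ v → (v ∈? R) ×-dec
        (any? (λ p → any? (λ q → all? (λ r → E? v r →-dec ((r ≟ p) ⊎-dec (r ≟ q)))))
         ⊎-dec all? (λ r → (r ∈? R) →-dec ¬? (D? v r)))

-- Menger's theorem for two paths

module _ {n : ℕ} where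

  private
    V = Fin n
    Rel = V → V → Set

  data Walk (L : Rel) : V → V → List V → Set where
    stop : ∀ {x} → Walk L x x (x ∷ [])
    step : ∀ {x y z vs} → L x z → Walk L z y vs → Walk L x y (x ∷ vs)

  module _ {L : Rel} where

    start∈ : ∀ {x y vs} → Walk L x y vs → x ∈ˡ vs
    start∈ stop = here refl
    start∈ (step _ _) = here refl

    end∈ : ∀ {x y vs} → Walk L x y vs → y ∈ˡ vs
    end∈ stop = here refl
    end∈ (step _ w) = there (end∈ w)

    snoc : ∀ {x y z vs} → Walk L x y vs → L y z → Walk L x z (vs ++ z ∷ [])
    snoc stop l = step l stop
    snoc (step l′ w) l = step l′ (snoc w l)

    reverseWalk : Symmetric L → ∀ {x y vs} → Walk L x y vs → ∃ λ us → Walk L y x us × (∀ {u} → u ∈ˡ us → u ∈ˡ vs)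
    reverseWalk L-sym stop = _ , stop , id
    reverseWalk L-sym (step {x} l w) with reverseWalk L-sym w
    ... | us , w′ , ⊆vs = us ++ x ∷ [] , snoc w′ (L-sym l) , back
      where
      back : ∀ {u} → u ∈ˡ us ++ x ∷ [] → u ∈ˡ x ∷ _
      back u∈ with ∈-++⁻ us u∈
      ... | inj₁ u∈us = there (⊆vs u∈us)
      ... | inj₂ (here u≡x) = here u≡x

    suffix : ∀ {x y z us} → Walk L z y us → Unique us → x ∈ˡ us →
             ∃ λ ws → Walk L x y ws × Unique ws × (∀ {u} → u ∈ˡ ws → u ∈ˡ us)
    suffix stop uniq (here refl) = _ , stop , uniq , id
    suffix w@(step _ _) uniq (here refl) = _ , w , uniq , id
    suffix (step _ w) (_ ∷ uniq) (there x∈) with suffix w uniq x∈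
    ... | ws , w′ , uniq′ , ⊆us = ws , w′ , uniq′ , there ∘ ⊆us

    simplify : ∀ {x y vs} → Walk L x y vs →
               ∃ λ us → Walk L x y us × Unique us × (∀ {u} → u ∈ˡ us → u ∈ˡ vs)
    simplify stop = _ , stop , [] ∷ [] , id
    simplify (step {x} l w) with simplify w
    ... | us , w′ , uniq , ⊆vs with member? _≟_ x us
    ...   | no x∉ = x ∷ us , step l w′ , All-tabulate (λ { u∈ refl → x∉ u∈ }) ∷ uniq
                  , λ { (here p) → here p ; (there u∈) → there (⊆vs u∈) }
    ...   | yes x∈ with suffix w′ uniq x∈
    ...     | ws , w″ , uniq″ , ⊆us = ws , w″ , uniq″ , there ∘ ⊆vs ∘ ⊆us

  mapWalk : ∀ {L L′ : Rel} → (∀ {x y} → L x y → L′ x y) → ∀ {x y vs} → Walk L x y vs → Walk L′ x y vs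
  mapWalk f stop = stop
  mapWalk f (step l w) = step (f l) (mapWalk f w)

  concatWalk : ∀ {L : Rel} {x p q y vs ws} → Walk L x p vs → L p q → Walk L q y ws → Walk L x y (vs ++ ws)
  concatWalk stop l w = step l w
  concatWalk (step l′ v) l w = step l′ (concatWalk v l w)

  record Linkage (L : Rel) (A B : Subset n) : Set where
    constructor linkage
    field
      {x₁ y₁ x₂ y₂} : V
      {vs₁ vs₂} : List V
      walk₁ : Walk L x₁ y₁ vs₁
      walk₂ : Walk L x₂ y₂ vs₂
      x₁∈ : x₁ ∈ A
      y₁∈ : y₁ ∈ B
      x₂∈ : x₂ ∈ A
      y₂∈ : y₂ ∈ B
      disjoint : ∀ {v} → v ∈ˡ vs₁ → v ∉ˡ vs₂

  -- A separator of at most one vertex, encoded by the set of vertices on the `A` side instead of a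
  -- condition on all walks. The separator may itself belong to `A` or `B`.
  record VertexCut (L : Rel) (A B : Subset n) : Set where
    constructor vertexCut
    field
      vertex : V
      side   : Subset n
      v∉     : vertex ∉ side
      A⊆     : ∀ {x} → x ∈ A → x ≢ vertex → x ∈ side
      B∉     : ∀ {y} → y ∈ B → y ∉ side
      cross  : ∀ {x y} → x ∈ side → y ∉ side → L x y → y ≡ vertex

  pair? : ∀ s p → U.Decidable (λ (x : V) → x ≡ s ⊎ x ≡ p)
  pair? s p x = (x ≟ s) ⊎-dec (x ≟ p)

  -- Göring's induction step for Menger's theorem: if the new edge p q crosses a one-vertex cut s,
  -- recurse on A against {s, p} and on {s, q} against B.
  module AddEdge {L L′ : Rel} {A B : Subset n} {p q : V}
      (L⊆L′ : ∀ {x y} → L x y → L′ x y) (pq : L′ p q)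
      (L′-inv : ∀ {x y} → L′ x y → L x y ⊎ (x ≡ p × y ≡ q) ⊎ (x ≡ q × y ≡ p))
      (C : VertexCut L A B) where

    open VertexCut C renaming (vertex to s; side to X; v∉ to s∉X)

    A∖s : ∀ {x} → x ∈ A → x ≡ s ⊎ x ∈ X
    A∖s {x} x∈ with x ≟ s
    ... | yes x≡s = inj₁ x≡s
    ... | no x≢s = inj₂ (A⊆ x∈ x≢s)

    stays : ∀ {x y vs} → Walk L x y vs → x ∈ X → s ∉ˡ vs → ∀ {u} → u ∈ˡ vs → u ∈ X
    stays stop x∈ s∉ (here refl) = x∈
    stays (step l w) x∈ s∉ (here refl) = x∈
    stays (step {z = z} l w) x∈ s∉ (there u∈) = stays w z∈ (s∉ ∘ there) u∈
      where
      z∈ : z ∈ X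
      z∈ with z ∈? X
      ... | yes z∈ = z∈
      ... | no z∉ = ⊥-elim (s∉ (there (subst (_∈ˡ _) (cross x∈ z∉ l) (start∈ w))))

    -- `X` can be left only into `s` and the walk ends outside `X`, so everything after the last
    -- visit to `s` avoids `X`.
    fromLast : ∀ {z y ws} → Walk L z y ws → y ∈ B →
      (∃ λ us → Walk L s y us × s ∈ˡ ws × (∀ {u} → u ∈ˡ us → u ≡ s ⊎ (u ∉ X × u ∈ˡ ws)))
      ⊎ (s ∉ˡ ws × (∀ {u} → u ∈ˡ ws → u ∉ X))
    fromLast {z} stop y∈ with z ≟ s
    ... | yes refl = inj₁ (_ , stop , here refl , λ { (here u≡s) → inj₁ u≡s })
    ... | no z≢s = inj₂ ((λ { (here s≡z) → z≢s (sym s≡z) }) , λ { (here refl) → B∉ y∈ })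
    fromLast {z} (step {z = z′} l w) y∈ with fromLast w y∈
    ... | inj₁ (us , w′ , s∈ , h) = inj₁ (us , w′ , there s∈ , [ inj₁ , (λ { (u∉ , u∈) → inj₂ (u∉ , there u∈) }) ]′ ∘ h)
    ... | inj₂ (s∉ , out) with z ≟ s
    ...   | yes refl = inj₁ (_ , step l w , here refl
                          , λ { (here u≡s) → inj₁ u≡s ; (there u∈) → inj₂ (out u∈ , there u∈) })
    ...   | no z≢s = inj₂ ((λ { (here s≡z) → z≢s (sym s≡z) ; (there s∈) → s∉ s∈ })
                         , λ { (here refl) z∈ → s∉ (subst (_∈ˡ _) (cross z∈ (out (start∈ w)) l) (start∈ w))
                             ; (there u∈) → out u∈ })

    -- The first walk is cut off at its first arrival in `s`; until then it stays in `X`.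
    joinAt : ∀ {x y vs ws} → x ≡ s ⊎ x ∈ X → Walk L x s vs → Walk L′ s y ws →
             ∃ λ us → Walk L′ x y us × (∀ {u} → u ∈ˡ us → (u ∈ X × u ∈ˡ vs) ⊎ u ∈ˡ ws)
    joinAt (inj₁ refl) _ w = _ , w , inj₂
    joinAt (inj₂ s∈) stop w = ⊥-elim (s∉X s∈)
    joinAt (inj₂ x∈) (step {z = z} l v) w with joinAt z∈⊎ v w
      where
      z∈⊎ : z ≡ s ⊎ z ∈ X
      z∈⊎ with z ∈? X
      ... | yes z∈ = inj₂ z∈
      ... | no z∉ = inj₁ (cross x∈ z∉ l)
    ... | us , w′ , h = _ , step (L⊆L′ l) w′
        , λ { (here refl) → inj₁ (x∈ , here refl)
            ; (there u∈) → [ (λ { (u∈X , u∈) → inj₁ (u∈X , there u∈) }) , inj₂ ]′ (h u∈) }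

    module _ (p∈X : p ∈ X) (q∉X : q ∉ X) where

      sp = ⟦ pair? s p ⟧
      sq = ⟦ pair? s q ⟧

      -- Intersecting the two `A` sides works because an old edge leaving `X` ends in `s` and the
      -- new one starts at `p`, both outside `X₁`.
      cutLeft : VertexCut L A sp → VertexCut L′ A B
      cutLeft (vertexCut t X₁ t∉ A⊆₁ B∉₁ cross₁) =
        vertexCut t ⟦ X₂? ⟧ (t∉ ∘ proj₁ ∘ ∈⟦⟧⁻ X₂?) A⊆₂ (λ y∈ y∈₂ → B∉ y∈ (proj₂ (∈⟦⟧⁻ X₂? y∈₂))) cross₂
        where
        X₂? : U.Decidable (λ x → x ∈ X₁ × x ∈ X)
        X₂? x = (x ∈? X₁) ×-dec (x ∈? X)
        s∉₁ : s ∉ X₁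
        s∉₁ = B∉₁ (∈⟦⟧⁺ (pair? s p) (inj₁ refl))
        p∉₁ : p ∉ X₁
        p∉₁ = B∉₁ (∈⟦⟧⁺ (pair? s p) (inj₂ refl))
        A⊆₂ : ∀ {x} → x ∈ A → x ≢ t → x ∈ ⟦ X₂? ⟧
        A⊆₂ x∈ x≢t with A∖s x∈
        ... | inj₁ refl = ⊥-elim (s∉₁ (A⊆₁ x∈ x≢t))
        ... | inj₂ x∈X = ∈⟦⟧⁺ X₂? (A⊆₁ x∈ x≢t , x∈X)
        cross₂ : ∀ {x y} → x ∈ ⟦ X₂? ⟧ → y ∉ ⟦ X₂? ⟧ → L′ x y → y ≡ t
        cross₂ {x} {y} x∈ y∉ l′ with ∈⟦⟧⁻ X₂? x∈ | L′-inv l′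
        ... | x∈₁ , x∈X | inj₂ (inj₁ (refl , _)) = ⊥-elim (p∉₁ x∈₁)
        ... | x∈₁ , x∈X | inj₂ (inj₂ (refl , _)) = ⊥-elim (q∉X x∈X)
        ... | x∈₁ , x∈X | inj₁ l with y ∈? X₁
        ...   | no y∉₁ = cross₁ x∈₁ y∉₁ l
        ...   | yes y∈₁ with cross x∈X (λ y∈X → y∉ (∈⟦⟧⁺ X₂? (y∈₁ , y∈X))) l
        ...     | refl = ⊥-elim (s∉₁ y∈₁)

      -- Dually, the union of the sides works: an edge leaving `X` ends in `s` or `q`, and each of
      -- these is in `X₃` or equals the cut vertex `t`.
      cutRight : VertexCut L sq B → VertexCut L′ A B
      cutRight (vertexCut t X₃ t∉ A⊆₃ B∉₃ cross₃) =
        vertexCut t ⟦ X₄? ⟧ (λ t∈ → proj₂ (∈⟦⟧⁻ X₄? t∈) refl) A⊆₄ B∉₄ cross₄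
        where
        X₄? : U.Decidable (λ x → (x ∈ X ⊎ x ∈ X₃) × x ≢ t)
        X₄? x = ((x ∈? X) ⊎-dec (x ∈? X₃)) ×-dec ¬? (x ≟ t)
        s∈₃ : s ≢ t → s ∈ X₃
        s∈₃ = A⊆₃ (∈⟦⟧⁺ (pair? s q) (inj₁ refl))
        q∈₃ : q ≢ t → q ∈ X₃
        q∈₃ = A⊆₃ (∈⟦⟧⁺ (pair? s q) (inj₂ refl))
        A⊆₄ : ∀ {x} → x ∈ A → x ≢ t → x ∈ ⟦ X₄? ⟧
        A⊆₄ x∈ x≢t with A∖s x∈
        ... | inj₁ refl = ∈⟦⟧⁺ X₄? (inj₂ (s∈₃ x≢t) , x≢t)
        ... | inj₂ x∈X = ∈⟦⟧⁺ X₄? (inj₁ x∈X , x≢t)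
        B∉₄ : ∀ {y} → y ∈ B → y ∉ ⟦ X₄? ⟧
        B∉₄ y∈ y∈₄ with ∈⟦⟧⁻ X₄? y∈₄
        ... | inj₁ y∈X , _ = B∉ y∈ y∈X
        ... | inj₂ y∈₃ , _ = B∉₃ y∈ y∈₃
        cross₄ : ∀ {x y} → x ∈ ⟦ X₄? ⟧ → y ∉ ⟦ X₄? ⟧ → L′ x y → y ≡ t
        cross₄ {x} {y} x∈ y∉ l′ with y ≟ t
        ... | yes y≡t = y≡t
        ... | no y≢t with ∈⟦⟧⁻ X₄? x∈ | L′-inv l′
        ...   | _ | inj₂ (inj₁ (_ , refl)) = ⊥-elim (y∉ (∈⟦⟧⁺ X₄? (inj₂ (q∈₃ y≢t) , y≢t)))
        ...   | _ | inj₂ (inj₂ (_ , refl)) = ⊥-elim (y∉ (∈⟦⟧⁺ X₄? (inj₁ p∈X , y≢t)))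
        ...   | inj₂ x∈₃ , _ | inj₁ l = cross₃ x∈₃ (λ y∈₃ → y∉ (∈⟦⟧⁺ X₄? (inj₂ y∈₃ , y≢t))) l
        ...   | inj₁ x∈X , _ | inj₁ l with cross x∈X (λ y∈X → y∉ (∈⟦⟧⁺ X₄? (inj₁ y∈X , y≢t))) l
        ...     | refl = ⊥-elim (y∉ (∈⟦⟧⁺ X₄? (inj₂ (s∈₃ y≢t) , y≢t)))

      -- `X` keeps the two halves apart. The walk to `p` misses `s` and so stays in `X`; the walk
      -- from `q` misses `s` and so stays outside. The remaining walk is trimmed to pass from `X` to
      -- the outside exactly at `s`.
      join : ∀ {a a′ b b′ vs vs′ ws ws′} →
             Walk L a s vs → Walk L a′ p vs′ → a ∈ A → a′ ∈ A → (∀ {v} → v ∈ˡ vs → v ∉ˡ vs′) →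
             Walk L s b ws → Walk L q b′ ws′ → b ∈ B → b′ ∈ B → (∀ {v} → v ∈ˡ ws → v ∉ˡ ws′) →
             Linkage L′ A B
      join {a} {a′} {b} {b′} {vs} {vs′} {ws} {ws′} αs αp a∈ a′∈ disj βs βq b∈ b′∈ disj′
        with fromLast βs b∈ | fromLast βq b′∈
      ... | _ | inj₁ (_ , _ , s∈ws′ , _) = ⊥-elim (disj′ (start∈ βs) s∈ws′)
      ... | inj₂ (s∉ , _) | inj₂ _ = ⊥-elim (s∉ (start∈ βs))
      ... | inj₁ (us , βs′ , _ , h) | inj₂ (s∉ws′ , out) with joinAt (A∖s a∈) αs (mapWalk L⊆L′ βs′)
      ...   | ts , w , h′ = linkage w (concatWalk (mapWalk L⊆L′ αp) pq (mapWalk L⊆L′ βq)) a∈ b∈ a′∈ b′∈ apart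
        where
        s∉vs′ : s ∉ˡ vs′
        s∉vs′ = disj (end∈ αs)
        a′∈X : a′ ∈ X
        a′∈X = A⊆ a′∈ (λ { refl → s∉vs′ (start∈ αp) })
        apart : ∀ {v} → v ∈ˡ ts → v ∉ˡ vs′ ++ ws′
        apart v∈ v∈′ with h′ v∈ | ∈-++⁻ vs′ v∈′
        ... | inj₁ (_ , v∈vs) | inj₁ v∈vs′ = disj v∈vs v∈vs′
        ... | inj₁ (v∈X , _) | inj₂ v∈ws′ = out v∈ws′ v∈X
        ... | inj₂ v∈us | h″ with h v∈us | h″
        ...   | inj₁ refl | inj₁ s∈vs′ = s∉vs′ s∈vs′
        ...   | inj₁ refl | inj₂ s∈ws′ = s∉ws′ s∈ws′
        ...   | inj₂ (v∉X , _) | inj₁ v∈vs′ = v∉X (stays αp a′∈X s∉vs′ v∈vs′)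
        ...   | inj₂ (_ , v∈ws) | inj₂ v∈ws′ = disj′ v∈ws v∈ws′

      module _ (β : Linkage L sq B) where
        open Linkage β

        join′ : ∀ {a a′ vs vs′} → Walk L a s vs → Walk L a′ p vs′ → a ∈ A → a′ ∈ A →
                (∀ {v} → v ∈ˡ vs → v ∉ˡ vs′) → Linkage L′ A B
        join′ αs αp a∈ a′∈ disj with ∈⟦⟧⁻ (pair? s q) x₁∈ | ∈⟦⟧⁻ (pair? s q) x₂∈
        ... | inj₁ refl | inj₁ refl = ⊥-elim (disjoint (start∈ walk₁) (start∈ walk₂))
        ... | inj₂ refl | inj₂ refl = ⊥-elim (disjoint (start∈ walk₁) (start∈ walk₂))
        ... | inj₁ refl | inj₂ refl = join αs αp a∈ a′∈ disj walk₁ walk₂ y₁∈ y₂∈ disjoint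
        ... | inj₂ refl | inj₁ refl =
              join αs αp a∈ a′∈ disj walk₂ walk₁ y₂∈ y₁∈ (λ v∈ v∈′ → disjoint v∈′ v∈)

      joinLinkages : Linkage L A sp → Linkage L sq B → Linkage L′ A B
      joinLinkages α β with ∈⟦⟧⁻ (pair? s p) (Linkage.y₁∈ α) | ∈⟦⟧⁻ (pair? s p) (Linkage.y₂∈ α)
      ... | inj₁ refl | inj₁ refl = ⊥-elim (disjoint (end∈ walk₁) (end∈ walk₂))
        where open Linkage α
      ... | inj₂ refl | inj₂ refl = ⊥-elim (disjoint (end∈ walk₁) (end∈ walk₂))
        where open Linkage α
      ... | inj₁ refl | inj₂ refl = join′ β walk₁ walk₂ x₁∈ x₂∈ disjoint
        where open Linkage α
      ... | inj₂ refl | inj₁ refl = join′ β walk₂ walk₁ x₂∈ x₁∈ (λ v∈ v∈′ → disjoint v∈′ v∈)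
        where open Linkage α

      addCrossing : Linkage L A sp ⊎ VertexCut L A sp → Linkage L sq B ⊎ VertexCut L sq B →
                    Linkage L′ A B ⊎ VertexCut L′ A B
      addCrossing (inj₂ C₁) _ = inj₂ (cutLeft C₁)
      addCrossing (inj₁ _) (inj₂ C₃) = inj₂ (cutRight C₃)
      addCrossing (inj₁ α) (inj₁ β) = inj₁ (joinLinkages α β)

    addHarmless : (p ∈ X → q ∈ X ⊎ q ≡ s) → (q ∈ X → p ∈ X ⊎ p ≡ s) → VertexCut L′ A B
    addHarmless hp hq = vertexCut s X s∉X A⊆ B∉ cross′
      where
      cross′ : ∀ {x y} → x ∈ X → y ∉ X → L′ x y → y ≡ s
      cross′ x∈ y∉ l′ with L′-inv l′
      ... | inj₁ l = cross x∈ y∉ l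
      ... | inj₂ (inj₁ (refl , refl)) = [ ⊥-elim ∘ y∉ , id ]′ (hp x∈)
      ... | inj₂ (inj₂ (refl , refl)) = [ ⊥-elim ∘ y∉ , id ]′ (hq x∈)

  Link : List (V × V) → Rel
  Link ES x y = (x , y) ∈ˡ ES ⊎ (y , x) ∈ˡ ES

  -- Induction on the edge list, for all `A` and `B` at once because the crossing case changes the
  -- terminals.
  menger : ∀ ES (A B : Subset n) → V → Linkage (Link ES) A B ⊎ VertexCut (Link ES) A B
  menger [] A B v₀ with any? (λ x → any? (λ y → (¬? (x ≟ y)) ×-dec
                           (((x ∈? A) ×-dec (x ∈? B)) ×-dec ((y ∈? A) ×-dec (y ∈? B)))))
  ... | yes (x , y , x≢y , (xA , xB) , yA , yB) =
        inj₁ (linkage stop stop xA xB yA yB λ { (here refl) (here x≡y) → x≢y x≡y })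
  ... | no ¬two with any? (λ x → (x ∈? A) ×-dec (x ∈? B))
  ...   | yes (x , xA , xB) = inj₂ (vertexCut x (A ∖ x) (λ x∈ → proj₂ (∈∖⁻ x∈) refl) ∈∖⁺
            (λ y∈B y∈ → ¬two (_ , _ , proj₂ (∈∖⁻ y∈) , (proj₁ (∈∖⁻ y∈) , y∈B) , xA , xB))
            λ { _ _ (inj₁ ()) ; _ _ (inj₂ ()) })
  -- `A` and `B` are disjoint, so the empty separator would do; `v₀` supplies the vertex that the
  -- record asks for.
  ...   | no ¬one = inj₂ (vertexCut v₀ (A ∖ v₀) (λ v∈ → proj₂ (∈∖⁻ v∈) refl) ∈∖⁺
            (λ y∈B y∈ → ¬one (_ , proj₁ (∈∖⁻ y∈) , y∈B))
            λ { _ _ (inj₁ ()) ; _ _ (inj₂ ()) })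
  menger ((x₀ , y₀) ∷ ES) A B v₀ with menger ES A B v₀
  ... | inj₁ (linkage w₁ w₂ a b c d disj) = inj₁ (linkage (mapWalk later w₁) (mapWalk later w₂) a b c d disj)
    where
    later : ∀ {x y} → Link ES x y → Link ((x₀ , y₀) ∷ ES) x y
    later = [ inj₁ ∘ there , inj₂ ∘ there ]′
  ... | inj₂ C = add
    where
    open VertexCut C using () renaming (vertex to s; side to X)
    L′ = Link ((x₀ , y₀) ∷ ES)
    later : ∀ {x y} → Link ES x y → L′ x y
    later = [ inj₁ ∘ there , inj₂ ∘ there ]′
    inv : ∀ {x y} → L′ x y → Link ES x y ⊎ (x ≡ x₀ × y ≡ y₀) ⊎ (x ≡ y₀ × y ≡ x₀)
    inv (inj₁ (here refl)) = inj₂ (inj₁ (refl , refl))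
    inv (inj₁ (there h)) = inj₁ (inj₁ h)
    inv (inj₂ (here refl)) = inj₂ (inj₂ (refl , refl))
    inv (inj₂ (there h)) = inj₁ (inj₂ h)
    inv′ : ∀ {x y} → L′ x y → Link ES x y ⊎ (x ≡ y₀ × y ≡ x₀) ⊎ (x ≡ x₀ × y ≡ y₀)
    inv′ = [ inj₁ , [ inj₂ ∘ inj₂ , inj₂ ∘ inj₁ ]′ ]′ ∘ inv
    module Fwd = AddEdge {L′ = L′} later (inj₁ (here refl)) inv C
    module Bwd = AddEdge {L′ = L′} later (inj₂ (here refl)) inv′ C
    add : Linkage L′ A B ⊎ VertexCut L′ A B
    add with x₀ ∈? X | y₀ ∈? X | x₀ ≟ s | y₀ ≟ s
    ... | yes x∈ | yes y∈ | _ | _ = inj₂ (Fwd.addHarmless (λ _ → inj₁ y∈) (λ _ → inj₁ x∈))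
    ... | no x∉ | no y∉ | _ | _ = inj₂ (Fwd.addHarmless (λ x∈ → ⊥-elim (x∉ x∈)) (λ y∈ → ⊥-elim (y∉ y∈)))
    ... | yes x∈ | no y∉ | _ | yes y≡s = inj₂ (Fwd.addHarmless (λ _ → inj₂ y≡s) (λ y∈ → ⊥-elim (y∉ y∈)))
    ... | no x∉ | yes y∈ | yes x≡s | _ = inj₂ (Fwd.addHarmless (λ x∈ → ⊥-elim (x∉ x∈)) (λ _ → inj₂ x≡s))
    ... | yes x∈ | no y∉ | _ | no _ = Fwd.addCrossing x∈ y∉ (menger ES A _ v₀) (menger ES _ B v₀)
    ... | no x∉ | yes y∈ | no _ | _ = Bwd.addCrossing y∈ x∉ (menger ES A _ v₀) (menger ES _ B v₀)

-- Cycles from closed walks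

module _ {n : ℕ} where

  lookup-start : ∀ {L : Fin n → Fin n → Set} {a e vs} → Walk L a e vs →
                 ∀ i → toℕ i ≡ 0 → lookup vs i ≡ a
  lookup-start stop zero _ = refl
  lookup-start (step _ _) zero _ = refl

  lookup-end : ∀ {L : Fin n → Fin n → Set} {a e vs} → Walk L a e vs →
               ∀ i → suc (toℕ i) ≡ length vs → lookup vs i ≡ e
  lookup-end stop zero _ = refl
  lookup-end (step _ stop) zero ()
  lookup-end (step _ (step _ _)) zero ()
  lookup-end (step _ w) (suc i) eq = lookup-end w i (suc-injective eq)

  lookup-next : ∀ {L : Fin n → Fin n → Set} {a e vs} → Walk L a e vs →
                ∀ i j → toℕ j ≡ suc (toℕ i) → L (lookup vs i) (lookup vs j)
  lookup-next stop zero zero ()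
  lookup-next {L} (step {x} l w) zero (suc j) eq = subst (L x) (sym (lookup-start w j (suc-injective eq))) l
  lookup-next (step _ w) (suc i) (suc j) eq = lookup-next w i j (suc-injective eq)

  lookup-middle : ∀ (us : List (Fin n)) {b ws} →
                  ∃ λ (j : Fin (length (us ++ b ∷ ws))) → toℕ j ≡ length us × lookup (us ++ b ∷ ws) j ≡ b
  lookup-middle [] = zero , refl , refl
  lookup-middle (_ ∷ us) with lookup-middle us
  ... | j , eq , eq′ = suc j , cong suc eq , eq′

  lookup-unique : ∀ {vs : List (Fin n)} → Unique vs → ∀ i j → lookup vs i ≡ lookup vs j → i ≡ j
  lookup-unique (_ ∷ _) zero zero _ = refl
  lookup-unique (x∉ ∷ _) zero (suc j) eq = ⊥-elim (All-lookup x∉ (∈-lookup j) eq)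
  lookup-unique (x∉ ∷ _) (suc i) zero eq = ⊥-elim (All-lookup x∉ (∈-lookup i) (sym eq))
  lookup-unique (_ ∷ u) (suc i) (suc j) eq = cong suc (lookup-unique u i j eq)

  module _ (G : Graph n) where

    closeWalk : ∀ {a e vs m} → Walk (Adj G) a e vs → Adj G e a → Unique vs → length vs ≡ suc (suc (suc m)) → Cycle G
    closeWalk {a} {e} {vs} {m} w ea uniq len = record
      { m = m ; c = at
      ; inj = λ eq → toℕ-injective (trans (sym (toℕ-cast _ _)) (trans (cong toℕ (lookup-unique uniq _ _ eq)) (toℕ-cast _ _)))
      ; edges = λ i j → [ next i j , Graph.sym G ∘ next j i ]′ }
      where
      N = suc (suc (suc m))
      at : Fin N → Fin n
      at i = lookup vs (cast (sym len) i)
      next : ∀ i j → toℕ j ≡ suc (toℕ i) % N → Adj G (at i) (at j)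
      next i j eq with m≤n⇒m<n∨m≡n (toℕ<n i)
      ... | inj₁ i+1<N = lookup-next w _ _
            (trans (toℕ-cast _ j) (trans (trans eq (m<n⇒m%n≡m i+1<N)) (cong suc (sym (toℕ-cast _ i)))))
      -- The last index wraps around to zero: this is the closing edge `ea`.
      ... | inj₂ i+1≡N = subst₂ (Adj G)
            (sym (lookup-end w _ (trans (cong suc (toℕ-cast _ i)) (trans i+1≡N (sym len)))))
            (sym (lookup-start w _ (trans (toℕ-cast _ j) (trans eq (trans (cong (_% N) i+1≡N) (n%n≡0 N))))))
            ea

    -- The cycle runs through `a`, the first walk, `b` and the second walk. Both walks are nonempty,
    -- so `a b` is a chord.
    chord : Chordless G → ∀ {a b x₁ y₁ y₂ x₂ us₁ us₂} → Adj G a b →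
            Walk (Adj G) x₁ y₁ us₁ → Walk (Adj G) y₂ x₂ us₂ →
            Adj G a x₁ → Adj G y₁ b → Adj G b y₂ → Adj G x₂ a →
            Unique us₁ → Unique us₂ → (∀ {v} → v ∈ˡ us₁ → v ∉ˡ us₂) →
            (∀ {v} → v ∈ˡ us₁ ⊎ v ∈ˡ us₂ → v ≢ a × v ≢ b) → ⊥
    chord ch {a} {b} {us₁ = u₁ ∷ us₁} {us₂ = u₂ ∷ us₂} ab w₁ w₂ ax₁ y₁b by₂ x₂a uniq₁ uniq₂ disj avoid =
      ch C (zero , cast len ib , nonconsecutive , subst₂ (Adj G) (sym (lookup-start w _ (toℕ-cast (sym len) zero))) (sym atb) ab)
      where
      vs₂ = u₂ ∷ us₂
      vs = a ∷ u₁ ∷ us₁ ++ b ∷ vs₂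
      -- `us₁` and `us₂` are tails here: the cycle has `4 + m′` vertices, and `b` stands at position
      -- `2 + length us₁`.
      m′ = length us₁ + length us₂
      w : Walk (Adj G) a _ vs
      w = step ax₁ (concatWalk w₁ y₁b (step by₂ w₂))
      uniq : Unique vs
      uniq = All-tabulate (λ v∈ a≡v → a∉ (subst (_∈ˡ _) (sym a≡v) v∈))
             ∷ ++⁺ uniq₁ (All-tabulate (λ { v∈ refl → proj₂ (avoid (inj₂ v∈)) refl }) ∷ uniq₂)
                 λ { (v∈ , here refl) → proj₂ (avoid (inj₁ v∈)) refl ; (v∈ , there v∈′) → disj v∈ v∈′ }
        where
        a∉ : a ∉ˡ u₁ ∷ us₁ ++ b ∷ vs₂
        a∉ a∈ with ∈-++⁻ (u₁ ∷ us₁) a∈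
        ... | inj₁ a∈₁ = proj₁ (avoid (inj₁ a∈₁)) refl
        ... | inj₂ (here refl) = irrefl G ab
        ... | inj₂ (there a∈₂) = proj₁ (avoid (inj₂ a∈₂)) refl
      len : length vs ≡ suc (suc (suc (suc m′)))
      len = cong (2 +_) (trans (length-++ us₁) (trans (+-suc _ _) (cong suc (+-suc _ _))))
      C : Cycle G
      C = closeWalk w x₂a uniq len
      ib : Fin (length vs)
      ib = suc (suc (proj₁ (lookup-middle us₁ {b} {vs₂})))
      toℕ-ib : toℕ (cast len ib) ≡ suc (suc (length us₁))
      toℕ-ib = trans (toℕ-cast len ib) (cong (2 +_) (proj₁ (proj₂ (lookup-middle us₁ {b} {vs₂}))))
      atb : c C (cast len ib) ≡ b
      atb = trans (cong (lookup vs) {x = cast (sym len) (cast len ib)} {y = ib} (toℕ-injective (trans (toℕ-cast (sym len) (cast len ib)) (toℕ-cast len ib))))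
                  (proj₂ (proj₂ (lookup-middle us₁ {b} {vs₂})))
      nonconsecutive : ¬ Consecutive {suc (suc (suc m′))} zero (cast len ib)
      nonconsecutive (inj₁ eq) with trans (sym toℕ-ib) eq
      ... | ()
      nonconsecutive (inj₂ eq)
        with trans eq (trans (cong (λ k → suc k % suc (suc (suc (suc m′)))) toℕ-ib)
                        (m<n⇒m%n≡m (s≤s (s≤s (s≤s (s≤s (m≤m+n (length us₁) (length us₂))))))))
      ... | ()

    -- Separating the ends of an edge in a chordless graph

    module _ (a b : Fin n) where

      edgeAvoiding? : U.Decidable (λ ((x , y) : Fin n × Fin n) → Adj G x y × (x ≢ a × x ≢ b) × (y ≢ a × y ≢ b))
      edgeAvoiding? (x , y) = adj? G x y ×-dec ((¬? (x ≟ a) ×-dec ¬? (x ≟ b)) ×-dec (¬? (y ≟ a) ×-dec ¬? (y ≟ b)))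

      edgesAvoiding : List (Fin n × Fin n)
      edgesAvoiding = filter edgeAvoiding? (cartesianProduct (allFin n) (allFin n))

      edgesAvoiding⁺ : ∀ {x y} → Adj G x y → x ≢ a × x ≢ b → y ≢ a × y ≢ b → Link edgesAvoiding x y
      edgesAvoiding⁺ xy hx hy =
        inj₁ (∈-filter⁺ edgeAvoiding? (∈-cartesianProduct⁺ (∈-allFin _) (∈-allFin _)) (xy , hx , hy))

      edgesAvoiding⁻ : ∀ {x y} → Link edgesAvoiding x y → Adj G x y × (x ≢ a × x ≢ b) × (y ≢ a × y ≢ b)
      edgesAvoiding⁻ (inj₁ h) = proj₂ (∈-filter⁻ edgeAvoiding? {xs = cartesianProduct (allFin n) (allFin n)} h)
      edgesAvoiding⁻ (inj₂ h) with proj₂ (∈-filter⁻ edgeAvoiding? {xs = cartesianProduct (allFin n) (allFin n)} h)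
      ... | yx , hy , hx = Graph.sym G yx , hx , hy

      walk-avoids : ∀ {x y vs} → Walk (Link edgesAvoiding) x y vs → x ≢ a × x ≢ b →
                    ∀ {v} → v ∈ˡ vs → v ≢ a × v ≢ b
      walk-avoids stop hx (here refl) = hx
      walk-avoids (step _ _) hx (here refl) = hx
      walk-avoids (step l w) hx (there v∈) = walk-avoids w (proj₂ (proj₂ (edgesAvoiding⁻ l))) v∈

    otherNbr? : ∀ a b → U.Decidable (λ x → Adj G a x × x ≢ b)
    otherNbr? a b x = adj? G a x ×-dec ¬? (x ≟ b)

    -- Menger's theorem is applied with `a` and `b` deleted, between the other neighbours of `a` and
    -- those of `b`. Two disjoint walks would make `a b` a chord, so there is a one-vertex cut.
    chordless⇒separation : Chordless G → ∀ {a b} → Adj G a b → Separation (Adj G) a b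
    chordless⇒separation ch {a} {b} ab
      with menger (edgesAvoiding a b) ⟦ otherNbr? a b ⟧ ⟦ otherNbr? b a ⟧ a
    ... | inj₁ (linkage w₁ w₂ x₁∈ y₁∈ x₂∈ y₂∈ disj)
        with ∈⟦⟧⁻ (otherNbr? a b) x₁∈ | ∈⟦⟧⁻ (otherNbr? b a) y₁∈ | ∈⟦⟧⁻ (otherNbr? a b) x₂∈ | ∈⟦⟧⁻ (otherNbr? b a) y₂∈
           | simplify w₁ | reverseWalk [ inj₂ , inj₁ ]′ w₂
    ...   | ax₁ , x₁≢b | by₁ , _ | ax₂ , x₂≢b | by₂ , _ | us₁ , w₁′ , uniq₁ , ⊆₁ | us₂ , w₂′ , ⊆₂
          with simplify w₂′
    ...     | ts₂ , w₂″ , uniq₂ , ⊆₂′ =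
              ⊥-elim (chord ch ab (mapWalk adj w₁′) (mapWalk adj w₂″) ax₁ (Graph.sym G by₁) by₂ (Graph.sym G ax₂)
                        uniq₁ uniq₂ (λ v∈ v∈′ → disj (⊆₁ v∈) (⊆₂ (⊆₂′ v∈′)))
                        [ walk-avoids a b w₁ (loop ax₁ , x₁≢b) ∘ ⊆₁ , walk-avoids a b w₂ (loop ax₂ , x₂≢b) ∘ ⊆₂ ∘ ⊆₂′ ]′)
      where
      adj : ∀ {x y} → Link (edgesAvoiding a b) x y → Adj G x y
      adj = proj₁ ∘ edgesAvoiding⁻ a b
      loop : ∀ {x y} → Adj G x y → y ≢ x
      loop xy refl = irrefl G xy
    chordless⇒separation ch {a} {b} ab | inj₂ (vertexCut s X₀ s∉ A⊆ B∉ cross) =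
      record { side = ⟦ X? ⟧ ; cut = cut ; a∈ = ∈⟦⟧⁺ X? (inj₁ refl) ; b∉ = b∉ ; cut≢b = cut≢b ; cross = cross′ }
      where
      -- `a` and `b` are isolated in the graph given to `menger`, so their place relative to `X₀`
      -- means nothing and is set by hand.
      X? : U.Decidable (λ x → x ≡ a ⊎ (x ∈ X₀ × x ≢ b))
      X? x = (x ≟ a) ⊎-dec ((x ∈? X₀) ×-dec ¬? (x ≟ b))
      a≢b : a ≢ b
      a≢b refl = irrefl G ab
      b∉ : b ∉ ⟦ X? ⟧
      b∉ b∈ = [ a≢b ∘ sym , (λ h → proj₂ h refl) ]′ (∈⟦⟧⁻ X? b∈)
      -- `menger` may return `b` as cut vertex. Then no other vertex has to be removed, and `a`
      -- encodes this.
      cutData : ∃ λ c → c ≢ b × (∀ {y} → y ≢ b → y ≡ s → y ≡ c)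
      cutData with s ≟ b
      ... | yes refl = a , a≢b , λ y≢b y≡b → ⊥-elim (y≢b y≡b)
      ... | no s≢b = s , s≢b , λ _ → id
      cut = proj₁ cutData
      cut≢b = proj₁ (proj₂ cutData)
      cross′ : ∀ {x y} → x ∈ ⟦ X? ⟧ → y ∉ ⟦ X? ⟧ → Adj G x y → (x ≡ a × y ≡ b) ⊎ y ≡ cut
      cross′ {x} {y} x∈ y∉ xy with y ≟ b | x ≟ a
      ... | yes y≡b | yes x≡a = inj₁ (x≡a , y≡b)
      ... | yes refl | no x≢a =
            ⊥-elim ([ x≢a , (λ h → B∉ (∈⟦⟧⁺ (otherNbr? b a) (Graph.sym G xy , x≢a)) (proj₁ h)) ]′ (∈⟦⟧⁻ X? x∈))
      ... | no y≢b | x≟a = inj₂ (proj₂ (proj₂ cutData) y≢b (reach x≟a))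
        where
        y≢a : y ≢ a
        y≢a y≡a = y∉ (∈⟦⟧⁺ X? (inj₁ y≡a))
        y∉X₀ : y ∉ X₀
        y∉X₀ y∈ = y∉ (∈⟦⟧⁺ X? (inj₂ (y∈ , y≢b)))
        reach : Dec (x ≡ a) → y ≡ s
        reach (yes refl) with y ≟ s
        ... | yes y≡s = y≡s
        ... | no y≢s = ⊥-elim (y∉X₀ (A⊆ (∈⟦⟧⁺ (otherNbr? a b) (xy , y≢b)) y≢s))
        reach (no x≢a) with ∈⟦⟧⁻ X? x∈
        ... | inj₁ x≡a = ⊥-elim (x≢a x≡a)
        ... | inj₂ (x∈₀ , x≢b) = cross x∈₀ y∉X₀ (edgesAvoiding⁺ a b xy (x≢a , x≢b) (y≢a , y≢b))

-- Elimination

module _ {n : ℕ} (G : Graph n) where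

  private
    V = Fin n

  -- Conflicting edges are joined by an edge, so between a vertex of R being eliminated and a coloured
  -- edge it suffices to follow paths with at most two eliminated interior vertices.
  Near : Subset n → V → V → Set
  Near D d r = Adj G d r ⊎ ∃ λ d′ → d′ ∈ D × Adj G d d′ × Adj G d′ r

  -- `D` collects the suppressed vertices only; discarded ones are in neither `R` nor `D`. `P d` and
  -- `Q d` bound what can be reached in `R` from `d`, which is the count needed when a vertex is
  -- discarded later.
  record State (R D : Subset n) : Set₁ where
    field
      E        : V → V → Set
      E?       : Decidable E
      E-sym    : Symmetric E
      E-irr    : ∀ {x} → ¬ E x x
      E⊆R      : Relates E R
      disjoint : ∀ {d} → d ∈ D → d ∉ R
      closed   : ∀ {r x} → r ∈ R → Adj G r x → x ∈ R ⊎ x ∈ D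
      adj⇒E    : ∀ {r s} → r ∈ R → s ∈ R → Adj G r s → E r s
      path⇒E   : ∀ {r d s} → r ∈ R → d ∈ D → s ∈ R → r ≢ s → Adj G r d → Near D d s → E r s
      P Q      : V → V
      near     : ∀ {d r} → d ∈ D → r ∈ R → Near D d r → r ≡ P d ⊎ r ≡ Q d
      separate : ∀ {a b} → a ∈ R → b ∈ R → Adj G a b → Separation E a b

  initial : Chordless G → State ⊤ ∅
  initial ch = record
    { E = Adj G ; E? = adj? G ; E-sym = Graph.sym G ; E-irr = irrefl G
    ; E⊆R = λ _ → ∈⊤ , ∈⊤ ; disjoint = ⊥-elim ∘ ∉⊥ ; closed = λ _ _ → inj₁ ∈⊤
    ; adj⇒E = λ _ _ → id ; path⇒E = λ _ d∈ → ⊥-elim (∉⊥ d∈)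
    ; P = id ; Q = id ; near = λ d∈ → ⊥-elim (∉⊥ d∈)
    ; separate = λ _ _ → chordless⇒separation G ch }

  -- `v` need not enter `D`: on the paths in question every interior vertex is adjacent to an end in
  -- `R`, and `v` has no such neighbour.
  discard : ∀ {R D v} → State R D → (∀ r → r ∈ R → ¬ Adj G v r) → State (R ∖ v) D
  discard {R} {D} {v} st isolated = record
    { E = λ x y → E x y × x ≢ v × y ≢ v
    ; E? = λ x y → E? x y ×-dec (¬? (x ≟ v) ×-dec ¬? (y ≟ v))
    ; E-sym = λ (xy , x≢ , y≢) → E-sym xy , y≢ , x≢
    ; E-irr = E-irr ∘ proj₁
    ; E⊆R = λ (xy , x≢ , y≢) → ∈∖⁺ (proj₁ (E⊆R xy)) x≢ , ∈∖⁺ (proj₂ (E⊆R xy)) y≢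
    ; disjoint = λ d∈ d∈R → disjoint d∈ (proj₁ (∈∖⁻ d∈R))
    ; closed = closed′
    ; adj⇒E = λ r∈ s∈ rs → adj⇒E (old r∈) (old s∈) rs , proj₂ (∈∖⁻ r∈) , proj₂ (∈∖⁻ s∈)
    ; path⇒E = λ r∈ d∈ s∈ r≢s rd ds →
        path⇒E (old r∈) d∈ (old s∈) r≢s rd ds , proj₂ (∈∖⁻ r∈) , proj₂ (∈∖⁻ s∈)
    ; P = P ; Q = Q ; near = λ d∈ r∈ → near d∈ (old r∈)
    ; separate = λ a∈ b∈ ab → restrict (separate (old a∈) (old b∈) ab) }
    where
    open State st
    old : ∀ {x} → x ∈ R ∖ v → x ∈ R
    old = proj₁ ∘ ∈∖⁻
    closed′ : ∀ {r x} → r ∈ R ∖ v → Adj G r x → x ∈ R ∖ v ⊎ x ∈ D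
    closed′ r∈ rx = Sum.map₁ (λ x∈ → ∈∖⁺ x∈ λ { refl → isolated _ (old r∈) (Graph.sym G rx) }) (closed (old r∈) rx)
    restrict : ∀ {a b} → Separation E a b → Separation (λ x y → E x y × x ≢ v × y ≢ v) a b
    restrict (separation X c a∈ b∉ c≢b cross) = separation X c a∈ b∉ c≢b λ x∈ y∉ → cross x∈ y∉ ∘ proj₁

  module _ {R D : Subset n} {v : V} (st : State R D) (v∈R : v ∈ R) where
    open State st

    private
      R′ = R ∖ v

      added? : U.Decidable (λ x → x ∈ D ⊎ x ≡ v)
      added? x = (x ∈? D) ⊎-dec (x ≟ v)

      D′ = ⟦ added? ⟧

      E′ : V → V → Set
      E′ x y = (x ∈ R′ × y ∈ R′) × x ≢ y × (E x y ⊎ (E x v × E v y))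

      old : ∀ {x} → x ∈ R′ → x ∈ R
      old = proj₁ ∘ ∈∖⁻

      new : ∀ {x} → x ∈ R′ → x ≢ v
      new = proj₂ ∘ ∈∖⁻

      near-v : ∀ {r} → r ∈ R′ → Near D′ v r → E v r
      near-v r∈ (inj₁ vr) = adj⇒E v∈R (old r∈) vr
      near-v r∈ (inj₂ (d , d∈ , vd , dr)) with ∈⟦⟧⁻ added? d∈
      ... | inj₁ d∈D = path⇒E v∈R d∈D (old r∈) (new r∈ ∘ sym) vd (inj₁ dr)
      ... | inj₂ refl = ⊥-elim (irrefl G vd)

      near-nbr : ∀ {d r} → d ∈ D → r ∈ R′ → Adj G d v → Near D′ d r → E v r
      near-nbr d∈D r∈ dv (inj₁ dr) = path⇒E v∈R d∈D (old r∈) (new r∈ ∘ sym) (Graph.sym G dv) (inj₁ dr)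
      near-nbr d∈D r∈ dv (inj₂ (d′ , d′∈ , dd′ , d′r)) with ∈⟦⟧⁻ added? d′∈
      ... | inj₁ d′∈D = path⇒E v∈R d∈D (old r∈) (new r∈ ∘ sym) (Graph.sym G dv) (inj₂ (d′ , d′∈D , dd′ , d′r))
      ... | inj₂ refl = adj⇒E v∈R (old r∈) d′r

      near-far : ∀ {d r} → ¬ Adj G d v → Near D′ d r → Near D d r
      near-far ¬dv (inj₁ dr) = inj₁ dr
      near-far ¬dv (inj₂ (d′ , d′∈ , dd′ , d′r)) with ∈⟦⟧⁻ added? d′∈
      ... | inj₁ d′∈D = inj₂ (d′ , d′∈D , dd′ , d′r)
      ... | inj₂ refl = ⊥-elim (¬dv dd′)

      -- If the first interior vertex is `v` or adjacent to `v`, both ends are `E`-neighbours of `v`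
      -- and suppression links them. Otherwise the path avoids `v` and was accounted for before.
      path′ : ∀ {r d s} → r ∈ R′ → d ∈ D′ → s ∈ R′ → r ≢ s → Adj G r d → Near D′ d s → E′ r s
      path′ {r} {d} {s} r∈ d∈ s∈ r≢s rd ds = (r∈ , s∈) , r≢s , link (∈⟦⟧⁻ added? d∈) (adj? G d v)
        where
        link : d ∈ D ⊎ d ≡ v → Dec (Adj G d v) → E r s ⊎ (E r v × E v s)
        link (inj₂ refl) _ = inj₂ (adj⇒E (old r∈) v∈R rd , near-v s∈ ds)
        link (inj₁ d∈D) (yes dv) = inj₂ (path⇒E (old r∈) d∈D v∈R (new r∈) rd (inj₁ dv) , near-nbr d∈D s∈ dv ds)
        link (inj₁ d∈D) (no ¬dv) = inj₁ (path⇒E (old r∈) d∈D (old s∈) r≢s rd (near-far ¬dv ds))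

    module _ {p q : V} (nbrs-v : ∀ r → E v r → r ≡ p ⊎ r ≡ q) where

      private
        -- A link through `v` that crosses `X` has a crossing half. `v` is neither `a` nor `b`, so
        -- unless `v` is the cut vertex the link ends in the old cut vertex.
        sep′ : ∀ {a b} → a ∈ R′ → b ∈ R′ → Adj G a b → Separation E′ a b
        sep′ {a} {b} a∈R b∈R ab = go (separate (old a∈R) (old b∈R) ab)
          where
          a≢b : a ≢ b
          a≢b refl = irrefl G ab
          go : Separation E a b → Separation E′ a b
          go (separation X c a∈ b∉ c≢b cross) with v ≟ c
          ... | no v≢c = separation X c a∈ b∉ c≢b cross₁
            where
            cross₁ : ∀ {x y} → x ∈ X → y ∉ X → E′ x y → (x ≡ a × y ≡ b) ⊎ y ≡ c
            cross₁ x∈ y∉ (_ , _ , inj₁ xy) = cross x∈ y∉ xy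
            cross₁ x∈ y∉ (_ , _ , inj₂ (xv , vy)) with v ∈? X
            ... | yes v∈ = [ ⊥-elim ∘ new a∈R ∘ sym ∘ proj₁ , inj₂ ]′ (cross v∈ y∉ vy)
            ... | no v∉ = ⊥-elim ([ new b∈R ∘ sym ∘ proj₂ , v≢c ]′ (cross x∈ v∉ xv))
          -- The cut vertex itself is suppressed: one of its two neighbours takes over, if that is still needed.
          ... | yes refl = choose (outer ≟ b) (inner ≟ a) (inner ≟ b)
            where
            -- As `v` has only two neighbours, all links through `v` leaving `X` have the same inner
            -- and outer end.
            ends : ∃₂ λ i o → ∀ {x y} → x ∈ X → y ∉ X → E v x → E v y → x ≡ i × y ≡ o
            ends with p ∈? X
            ... | yes p∈ = p , q , λ x∈ y∉ vx vy →
                  let y≡q = [ (λ { refl → ⊥-elim (y∉ p∈) }) , id ]′ (nbrs-v _ vy) in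
                  [ id , (λ x≡q → ⊥-elim (y∉ (subst (_∈ X) (trans x≡q (sym y≡q)) x∈))) ]′ (nbrs-v _ vx) , y≡q
            ... | no p∉ = q , p , λ x∈ y∉ vx vy →
                  let x≡q = [ (λ { refl → ⊥-elim (p∉ x∈) }) , id ]′ (nbrs-v _ vx) in
                  x≡q , [ id , (λ y≡q → ⊥-elim (y∉ (subst (_∈ X) (trans x≡q (sym y≡q)) x∈))) ]′ (nbrs-v _ vy)
            inner = proj₁ ends
            outer = proj₁ (proj₂ ends)
            through : ∀ {x y} → x ∈ X → y ∉ X → E′ x y → (x ≡ a × y ≡ b) ⊎ (x ≡ inner × y ≡ outer)
            through x∈ y∉ ((_ , y∈R) , _ , inj₁ xy) =
              [ inj₁ , (λ y≡v → ⊥-elim (new y∈R y≡v)) ]′ (cross x∈ y∉ xy)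
            through x∈ y∉ (_ , _ , inj₂ (xv , vy)) = inj₂ (proj₂ (proj₂ ends) x∈ y∉ (E-sym xv) vy)
            choose : Dec (outer ≡ b) → Dec (inner ≡ a) → Dec (inner ≡ b) → Separation E′ a b
            choose (no o≢b) _ _ = separation X outer a∈ b∉ o≢b λ x∈ y∉ e → Sum.map₂ proj₂ (through x∈ y∉ e)
            choose (yes o≡b) (yes i≡a) _ = separation X a a∈ b∉ a≢b λ x∈ y∉ e →
              inj₁ ([ id , (λ { (x≡i , y≡o) → trans x≡i i≡a , trans y≡o o≡b }) ]′ (through x∈ y∉ e))
            choose (yes o≡b) (no _) (yes i≡b) = separation X a a∈ b∉ a≢b λ x∈ y∉ e →
              inj₁ ([ id , (λ { (x≡i , _) → ⊥-elim (b∉ (subst (_∈ X) (trans x≡i i≡b) x∈)) }) ]′ (through x∈ y∉ e))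
            -- The outer end is `b`, which may not be the cut vertex, so the inner end is moved out
            -- of `X` to serve instead.
            choose (yes o≡b) (no i≢a) (no i≢b) =
              separation (X ∖ inner) inner (∈∖⁺ a∈ (i≢a ∘ sym)) (b∉ ∘ proj₁ ∘ ∈∖⁻) i≢b cross₂
              where
              cross₂ : ∀ {x y} → x ∈ X ∖ inner → y ∉ X ∖ inner → E′ x y → (x ≡ a × y ≡ b) ⊎ y ≡ inner
              cross₂ {x} {y} x∈ y∉ e with y ≟ inner
              ... | yes y≡i = inj₂ y≡i
              ... | no y≢i with through (proj₁ (∈∖⁻ x∈)) (λ y∈ → y∉ (∈∖⁺ y∈ y≢i)) e
              ...   | inj₁ h = inj₁ h
              ...   | inj₂ (x≡i , _) = ⊥-elim (proj₂ (∈∖⁻ x∈) x≡i)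

        close? : U.Decidable (λ d → d ≡ v ⊎ Adj G d v)
        close? d = (d ≟ v) ⊎-dec adj? G d v

        replace : ∀ {d} → Dec (d ≡ v ⊎ Adj G d v) → V → V → V
        replace (yes _) new old = new
        replace (no _) new old = old

        -- For `v` and its neighbours in `D`, whatever is near in the new `R` is an `E`-neighbour of
        -- `v`, hence `p` or `q`. For any other `d` nothing new becomes near, and the old bounds
        -- persist.
        near′ : ∀ {d r} → d ∈ D′ → r ∈ R′ → Near D′ d r → (close : Dec (d ≡ v ⊎ Adj G d v)) →
                r ≡ replace close p (P d) ⊎ r ≡ replace close q (Q d)
        near′ d∈ r∈ dr close with ∈⟦⟧⁻ added? d∈
        near′ d∈ r∈ dr (yes (inj₁ refl)) | _ = nbrs-v _ (near-v r∈ dr)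
        near′ d∈ r∈ dr (yes (inj₂ dv)) | inj₁ d∈D = nbrs-v _ (near-nbr d∈D r∈ dv dr)
        near′ d∈ r∈ dr (yes (inj₂ dv)) | inj₂ refl = ⊥-elim (irrefl G dv)
        near′ d∈ r∈ dr (no ¬close) | inj₁ d∈D = near d∈D (old r∈) (near-far (¬close ∘ inj₂) dr)
        near′ d∈ r∈ dr (no ¬close) | inj₂ d≡v = ⊥-elim (¬close (inj₁ d≡v))

      suppress : State R′ D′
      suppress = record
        { E = E′
        ; E? = λ x y → ((x ∈? R′) ×-dec (y ∈? R′)) ×-dec (¬? (x ≟ y) ×-dec (E? x y ⊎-dec (E? x v ×-dec E? v y)))
        ; E-sym = λ ((x∈ , y∈) , x≢y , h) →
            (y∈ , x∈) , x≢y ∘ sym , Sum.map E-sym (λ (xv , vy) → E-sym vy , E-sym xv) h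
        ; E-irr = λ (_ , x≢x , _) → x≢x refl
        ; E⊆R = proj₁
        ; disjoint = λ d∈ d∈R → [ (λ d∈D → disjoint d∈D (old d∈R)) , new d∈R ]′ (∈⟦⟧⁻ added? d∈)
        ; closed = closed′
        ; adj⇒E = λ r∈ s∈ rs → (r∈ , s∈) , (λ { refl → irrefl G rs }) , inj₁ (adj⇒E (old r∈) (old s∈) rs)
        ; path⇒E = path′
        ; P = λ d → replace (close? d) p (P d)
        ; Q = λ d → replace (close? d) q (Q d)
        ; near = λ d∈ r∈ dr → near′ d∈ r∈ dr (close? _)
        ; separate = sep′ }
        where
        closed′ : ∀ {r x} → r ∈ R′ → Adj G r x → x ∈ R′ ⊎ x ∈ D′
        closed′ {x = x} r∈ rx with x ≟ v | closed (old r∈) rx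
        ... | yes x≡v | _ = inj₂ (∈⟦⟧⁺ added? (inj₂ x≡v))
        ... | no x≢v | inj₁ x∈R = inj₁ (∈∖⁺ x∈R x≢v)
        ... | no _ | inj₂ x∈D = inj₂ (∈⟦⟧⁺ added? (inj₁ x∈D))

-- Greedy colouring

module _ {n : ℕ} (G : Graph n) where

  private
    V = Fin n

  neighbours : V → List V
  neighbours v = filter (adj? G v) (allFin n)

  ∈-neighbours : ∀ {u v} → Adj G v u → u ∈ˡ neighbours v
  ∈-neighbours vu = ∈-filter⁺ (adj? G _) (∈-allFin _) vu

  length-neighbours : ∀ v → length (neighbours v) ≡ degree G v
  length-neighbours v = go (allFin n)
    where
    go : ∀ xs → length (filter (adj? G v) xs) ≡ sum (map (λ u → if does (adj? G v u) then 1 else 0) xs)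
    go [] = refl
    go (x ∷ xs) with does (adj? G v x)
    ... | true = cong suc (go xs)
    ... | false = go xs

  degree≤maxDegree : ∀ v → degree G v ≤ maxDegree G
  degree≤maxDegree v = go (∈-allFin v)
    where
    go : ∀ {xs} → v ∈ˡ xs → degree G v ≤ foldr _⊔_ 0 (map (degree G) xs)
    go {x ∷ xs} (here refl) = m≤m⊔n _ _
    go {x ∷ xs} (there v∈) = ≤-trans (go v∈) (m≤n⊔m (degree G x) _)

  others : V → V → List V
  others v y = filter (λ u → ¬? (u ≟ y)) (neighbours v)

  ∈-others : ∀ {u v y} → Adj G v u → u ≢ y → u ∈ˡ others v y
  ∈-others {y = y} vu u≢y = ∈-filter⁺ (λ u → ¬? (u ≟ y)) (∈-neighbours vu) u≢y

  length-others : ∀ {v y} → Adj G v y → length (others v y) < degree G v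
  length-others {v} {y} vy = <-≤-trans
    (filter-notAll (λ u → ¬? (u ≟ y)) (neighbours v) (Any.map (λ { refl y≢y → y≢y refl }) (∈-neighbours vy)))
    (≤-reflexive (length-neighbours v))

  SameEdge : V → V → V → V → Set
  SameEdge u v x y = (u ≡ x × v ≡ y) ⊎ (u ≡ y × v ≡ x)

  sameEdge? : ∀ u v x y → Dec (SameEdge u v x y)
  sameEdge? u v x y = ((u ≟ x) ×-dec (v ≟ y)) ⊎-dec ((u ≟ y) ×-dec (v ≟ x))

  Touch : V → V → Set
  Touch u x = u ≡ x ⊎ Adj G u x

  Conflict : V → V → V → V → Set
  Conflict u v x y = (Touch u x ⊎ Touch u y) ⊎ (Touch v x ⊎ Touch v y)

  touch-sym : ∀ {u x} → Touch u x → Touch x u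
  touch-sym = Sum.map sym (Graph.sym G)

  conflict-sym : ∀ {u v x y} → Conflict u v x y → Conflict x y u v
  conflict-sym (inj₁ (inj₁ t)) = inj₁ (inj₁ (touch-sym t))
  conflict-sym (inj₁ (inj₂ t)) = inj₂ (inj₁ (touch-sym t))
  conflict-sym (inj₂ (inj₁ t)) = inj₁ (inj₂ (touch-sym t))
  conflict-sym (inj₂ (inj₂ t)) = inj₂ (inj₂ (touch-sym t))

  conflict-subst : ∀ {u v u′ v′ x y} → SameEdge u v u′ v′ → Conflict u′ v′ x y → Conflict u v x y
  conflict-subst (inj₁ (refl , refl)) = id
  conflict-subst (inj₂ (refl , refl)) = Sum.swap

  -- Only the length of the list matters for the colour count, so repetitions, non-edges and either
  -- orientation are tolerated.
  ListsEdge : List (V × V) → V → V → Set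
  ListsEdge L x z = (x , z) ∈ˡ L ⊎ (z , x) ∈ˡ L

  fresh : ∀ {k} (cs : List (Fin k)) → length cs < k → ∃ λ c → c ∉ˡ cs
  fresh {k} cs len = ¬∀⟶∃¬ k (_∈ˡ cs) (λ c → member? _≟_ c cs) λ all → clash all (pigeonhole len (index ∘ all))
    where
    clash : (all : ∀ c → c ∈ˡ cs) → ¬ (∃₂ λ i j → i <ᶠ j × index (all i) ≡ index (all j))
    clash all (i , j , i<j , eq) = Fin-<⇒≢ i<j
      (trans (lookup-index (all i)) (trans (cong (lookup cs) eq) (sym (lookup-index (all j)))))

  -- Extending a colouring by the edges at one vertex

  module _ {k : ℕ} where

    Colours = V → V → Fin k

    Proper : Colours → (V → V → Set) → Set
    Proper c S = (∀ u v → c u v ≡ c v u) ×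
      (∀ {u v x y} → S u v → S x y → DistinctEdges u v x y → Conflict u v x y → c u v ≢ c x y)

    proper-mono : ∀ {c} {S T : V → V → Set} → (∀ {x y} → T x y → S x y) → Proper c S → Proper c T
    proper-mono T⊆S (symm , ok) = symm , λ t t′ → ok (T⊆S t) (T⊆S t′)

    recolour : ∀ {v y x z} → Fin k → Fin k → Dec (SameEdge v y x z) → Fin k
    recolour new old (yes _) = new
    recolour new old (no _) = old

    addEdge : ∀ {c S} v y L → Proper c S → length L < k →
              (∀ {x z} → S x z → DistinctEdges v y x z → Conflict v y x z → ListsEdge L x z) →
              ∃ λ c′ → Proper c′ (λ x z → S x z ⊎ SameEdge v y x z)
    addEdge {c} {S} v y L (symm , ok) len cover = c′ , symm′ , λ {u} {w} {x} {z} → ok′ (sameEdge? v y u w) (sameEdge? v y x z)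
      where
      used = map (λ (x , z) → c x z) L
      new-data = fresh used (≤-trans (≤-reflexive (cong suc (length-map _ L))) len)
      new = proj₁ new-data
      c′ : Colours
      c′ x z = recolour new (c x z) (sameEdge? v y x z)
      symm″ : ∀ {u w} → (p : Dec (SameEdge v y u w)) (q : Dec (SameEdge v y w u)) →
              recolour new (c u w) p ≡ recolour new (c w u) q
      symm″ (yes _) (yes _) = refl
      symm″ (no _) (no _) = symm _ _
      symm″ (yes p) (no ¬q) = ⊥-elim (¬q (Sum.swap p))
      symm″ (no ¬p) (yes q) = ⊥-elim (¬p (Sum.swap q))
      symm′ : ∀ u w → c′ u w ≡ c′ w u
      symm′ u w = symm″ (sameEdge? v y u w) (sameEdge? v y w u)
      new≢ : ∀ {x z} → S x z → DistinctEdges v y x z → Conflict v y x z → new ≢ c x z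
      new≢ {x} {z} s distinct conf eq with cover s distinct conf
      ... | inj₁ xz∈ = proj₂ new-data (subst (_∈ˡ used) (sym eq) (∈-map⁺ (λ (x , z) → c x z) xz∈))
      ... | inj₂ zx∈ = proj₂ new-data (subst (_∈ˡ used) (sym (trans eq (symm x z))) (∈-map⁺ (λ (x , z) → c x z) zx∈))
      same-same : ∀ {u w x z} → SameEdge v y u w → SameEdge v y x z → SameEdge u w x z
      same-same (inj₁ (refl , refl)) q = q
      same-same (inj₂ (refl , refl)) (inj₁ (refl , refl)) = inj₂ (refl , refl)
      same-same (inj₂ (refl , refl)) (inj₂ (refl , refl)) = inj₁ (refl , refl)
      old : ∀ {x z} → ¬ SameEdge v y x z → S x z ⊎ SameEdge v y x z → S x z
      old ¬same = [ id , ⊥-elim ∘ ¬same ]′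
      ok′ : ∀ {u w x z} (p : Dec (SameEdge v y u w)) (q : Dec (SameEdge v y x z)) →
            S u w ⊎ SameEdge v y u w → S x z ⊎ SameEdge v y x z → DistinctEdges u w x z → Conflict u w x z →
            recolour new (c u w) p ≢ recolour new (c x z) q
      ok′ (yes p) (yes q) s t distinct conf = ⊥-elim (distinct (same-same p q))
      ok′ (yes p) (no ¬q) s t distinct conf = new≢ (old ¬q t) ¬q (conflict-subst p conf)
      ok′ (no ¬p) (yes q) s t distinct conf = new≢ (old ¬p s) ¬p (conflict-subst q (conflict-sym conf)) ∘ sym
      ok′ (no ¬p) (no ¬q) s t = ok (old ¬p s) (old ¬q t)

    -- `S` holds the edges coloured before the star of `v` is treated. `own` allows for star edges
    -- coloured earlier, so the list does not depend on their order.
    record Forbidden (S : V → V → Set) (v y : V) : Set where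
      constructor forbidden
      field
        edges : List (V × V)
        few   : length edges < k
        cover : ∀ {x z} → S x z → Conflict v y x z → ListsEdge edges x z
        own   : ∀ {y′} → Adj G v y′ → y′ ≢ y → (v , y′) ∈ˡ edges

    addStar : ∀ {c S} v ys → Proper c S → (∀ {y} → y ∈ˡ ys → Adj G v y × Forbidden S v y) →
              ∃ λ c′ → Proper c′ (λ x z → S x z ⊎ ∃ λ y → y ∈ˡ ys × SameEdge v y x z)
    addStar v [] proper _ = _ , proper-mono [ id , (λ { (_ , () , _) }) ]′ proper
    addStar {S = S} v (y ∷ ys) proper h with addStar v ys proper (h ∘ there) | h (here refl)
    ... | c , proper′ | vy , forbidden L few cover own =
          map₂ (proper-mono reorder) (addEdge v y L proper′ few cover′)
      where
      cover′ : ∀ {x z} → S x z ⊎ (∃ λ y′ → y′ ∈ˡ ys × SameEdge v y′ x z) →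
               DistinctEdges v y x z → Conflict v y x z → ListsEdge L x z
      cover′ (inj₁ s) _ conf = cover s conf
      cover′ (inj₂ (y′ , y′∈ , inj₁ (refl , refl))) distinct _ =
        inj₁ (own (proj₁ (h (there y′∈))) λ { refl → distinct (inj₁ (refl , refl)) })
      cover′ (inj₂ (y′ , y′∈ , inj₂ (refl , refl))) distinct _ =
        inj₂ (own (proj₁ (h (there y′∈))) λ { refl → distinct (inj₂ (refl , refl)) })
      reorder : ∀ {x z} → S x z ⊎ (∃ λ y′ → y′ ∈ˡ y ∷ ys × SameEdge v y′ x z) →
                (S x z ⊎ (∃ λ y′ → y′ ∈ˡ ys × SameEdge v y′ x z)) ⊎ SameEdge v y x z
      reorder (inj₁ s) = inj₁ (inj₁ s)
      reorder (inj₂ (_ , here refl , same)) = inj₂ same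
      reorder (inj₂ (y′ , there y′∈ , same)) = inj₁ (inj₂ (y′ , y′∈ , same))

  Coloured : Subset n → V → V → Set
  Coloured R x z = Adj G x z × (x ∈ R ⊎ z ∈ R)

  star : V → List (V × V)
  star v = map (v ,_) (neighbours v)

  ∈-star : ∀ {v z} → Adj G v z → (v , z) ∈ˡ star v
  ∈-star vz = ∈-map⁺ (_ ,_) (∈-neighbours vz)

  -- Counting the forbidden edges

  module Greedy {Δ : ℕ} (degree≤ : ∀ v → degree G v ≤ Δ) where

    private
      few-three : ∀ (K L M : List (V × V)) → length K ≤ Δ → length L ≤ Δ → length M < Δ →
                  length (K ++ L ++ M) < 3 * Δ
      few-three K L M k l m rewrite length-++ K {L ++ M} | length-++ L {M} | +-identityʳ Δ =
        +-mono-≤-< k (+-mono-≤-< l m)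

      length-star : ∀ v → length (star v) ≤ Δ
      length-star v = ≤-trans (≤-reflexive (trans (length-map _ (neighbours v)) (length-neighbours v))) (degree≤ v)

      length-map-others : ∀ {v y} (f : V → V × V) → Adj G v y → length (map f (others v y)) < Δ
      length-map-others {v} {y} f vy = <-≤-trans
        (≤-trans (≤-reflexive (cong suc (length-map f (others v y)))) (length-others vy)) (degree≤ v)

    -- A conflict is a path from `v`, possibly through `y`, to the other edge. Its interior in `D`
    -- has at most two vertices, so some end of that edge in `R` is an `E`-neighbour of `v`, that is
    -- `p` or `q`.
    forbid-suppressed : ∀ {R D v y p q} (st : State G R D) → v ∈ R → y ∈ D → Adj G v y →
                        (∀ r → State.E st v r → r ≡ p ⊎ r ≡ q) → Forbidden {3 * Δ} (Coloured (R ∖ v)) v y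
    forbid-suppressed {R} {D} {v} {y} {p} {q} st v∈R y∈D vy nbrs-v = forbidden
      (star p ++ star q ++ map (v ,_) (others v y))
      (few-three (star p) (star q) _ (length-star p) (length-star q) (length-map-others (v ,_) vy))
      cover (λ vy′ y′≢y → ∈-++⁺ʳ (star p) (∈-++⁺ʳ (star q) (∈-map⁺ (v ,_) (∈-others vy′ y′≢y))))
      where
      open State st
      L = star p ++ star q ++ map (v ,_) (others v y)
      listed : ∀ {r z} → E v r → Adj G r z → (r , z) ∈ˡ L
      listed vr rz with nbrs-v _ vr
      ... | inj₁ refl = ∈-++⁺ˡ (∈-star rz)
      ... | inj₂ refl = ∈-++⁺ʳ (star p) (∈-++⁺ˡ (∈-star rz))
      coverR : ∀ {x z} → x ∈ R ∖ v → Adj G x z → Conflict v y x z → ListsEdge L x z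
      coverR {x} {z} x∈ xz conf = go conf
        where
        x∈R = proj₁ (∈∖⁻ x∈)
        v≢x : v ≢ x
        v≢x v≡x = proj₂ (∈∖⁻ x∈) (sym v≡x)
        hit : E v x → ListsEdge L x z
        hit vx = inj₁ (listed vx xz)
        hit′ : E v z → ListsEdge L x z
        hit′ vz = inj₂ (listed vz (Graph.sym G xz))
        go : Conflict v y x z → ListsEdge L x z
        go (inj₁ (inj₁ (inj₁ v≡x))) = ⊥-elim (v≢x v≡x)
        go (inj₁ (inj₁ (inj₂ vx))) = hit (adj⇒E v∈R x∈R vx)
        go (inj₁ (inj₂ (inj₁ refl))) = hit (adj⇒E v∈R x∈R (Graph.sym G xz))
        go (inj₁ (inj₂ (inj₂ vz))) with closed x∈R xz
        ... | inj₁ z∈R = hit′ (adj⇒E v∈R z∈R vz)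
        ... | inj₂ z∈D = hit (path⇒E v∈R z∈D x∈R v≢x vz (inj₁ (Graph.sym G xz)))
        go (inj₂ (inj₁ (inj₁ refl))) = ⊥-elim (disjoint y∈D x∈R)
        go (inj₂ (inj₁ (inj₂ yx))) = hit (path⇒E v∈R y∈D x∈R v≢x vy (inj₁ yx))
        go (inj₂ (inj₂ (inj₁ refl))) = hit (path⇒E v∈R y∈D x∈R v≢x vy (inj₁ (Graph.sym G xz)))
        go (inj₂ (inj₂ (inj₂ yz))) with closed x∈R xz | v ≟ z
        ... | inj₂ z∈D | _ = hit (path⇒E v∈R y∈D x∈R v≢x vy (inj₂ (_ , z∈D , yz , Graph.sym G xz)))
        ... | inj₁ _ | yes refl = hit (adj⇒E v∈R x∈R (Graph.sym G xz))
        ... | inj₁ z∈R | no v≢z = hit′ (path⇒E v∈R y∈D z∈R v≢z vy (inj₁ yz))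
      cover : ∀ {x z} → Coloured (R ∖ v) x z → Conflict v y x z → ListsEdge L x z
      cover (xz , inj₁ x∈) conf = coverR x∈ xz conf
      cover (xz , inj₂ z∈) conf = Sum.swap (coverR z∈ (Graph.sym G xz) (Sum.map Sum.swap Sum.swap conf))

    forbid-discarded : ∀ {R D v y} (st : State G R D) → v ∈ R → y ∈ D → Adj G v y →
                       (∀ r → r ∈ R → ¬ Adj G v r) → Forbidden {3 * Δ} (Coloured (R ∖ v)) v y
    forbid-discarded {R} {D} {v} {y} st v∈R y∈D vy isolated = forbidden L
      (few-three (star (partner y)) (map (λ t → t , partner t) (others v y)) (map (v ,_) (others v y)) (length-star (partner y))
         (≤-trans (n≤1+n _) (length-map-others (λ t → t , partner t) vy)) (length-map-others (v ,_) vy))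
      cover (λ vy′ y′≢y → ∈-++⁺ʳ (star (partner y))
                            (∈-++⁺ʳ (map (λ t → t , partner t) (others v y)) (∈-map⁺ (v ,_) (∈-others vy′ y′≢y))))
      where
      open State st
      -- For a neighbour `d` of `v` in `D`, `v` itself is one of `P d` and `Q d`; the partner is the
      -- only other vertex of `R` that can be near `d`.
      partner : V → V
      partner d with P d ≟ v
      ... | yes _ = Q d
      ... | no _ = P d
      L = star (partner y) ++ map (λ t → t , partner t) (others v y) ++ map (v ,_) (others v y)
      partner-near : ∀ {d x} → d ∈ D → Adj G d v → x ∈ R ∖ v → Near G D d x → x ≡ partner d
      partner-near {d} d∈ dv x∈ dx with P d ≟ v | near d∈ (proj₁ (∈∖⁻ x∈)) dx
      ... | yes P≡v | inj₁ x≡P = ⊥-elim (proj₂ (∈∖⁻ x∈) (trans x≡P P≡v))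
      ... | yes _ | inj₂ x≡Q = x≡Q
      ... | no _ | inj₁ x≡P = x≡P
      ... | no P≢v | inj₂ x≡Q with near d∈ v∈R (inj₁ dv)
      ...   | inj₁ v≡P = ⊥-elim (P≢v (sym v≡P))
      ...   | inj₂ v≡Q = ⊥-elim (proj₂ (∈∖⁻ x∈) (trans x≡Q (sym v≡Q)))
      yv = Graph.sym G vy
      coverR : ∀ {x z} → x ∈ R ∖ v → Adj G x z → Conflict v y x z → ListsEdge L x z
      coverR {x} {z} x∈ xz conf = go conf
        where
        x∈R = proj₁ (∈∖⁻ x∈)
        zx = Graph.sym G xz
        hit : Near G D y x → ListsEdge L x z
        hit yx with partner-near y∈D yv x∈ yx
        ... | refl = inj₁ (∈-++⁺ˡ (∈-star xz))
        hit′ : z ∈ R ∖ v → Near G D y z → ListsEdge L x z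
        hit′ z∈ yz with partner-near y∈D yv z∈ yz
        ... | refl = inj₂ (∈-++⁺ˡ (∈-star zx))
        go : Conflict v y x z → ListsEdge L x z
        go (inj₁ (inj₁ (inj₁ v≡x))) = ⊥-elim (proj₂ (∈∖⁻ x∈) (sym v≡x))
        go (inj₁ (inj₁ (inj₂ vx))) = ⊥-elim (isolated _ x∈R vx)
        go (inj₁ (inj₂ (inj₁ refl))) = ⊥-elim (isolated _ x∈R zx)
        go (inj₁ (inj₂ (inj₂ vz))) with closed x∈R xz | z ≟ y
        ... | inj₁ z∈R | _ = ⊥-elim (isolated _ z∈R vz)
        ... | inj₂ _ | yes refl = hit (inj₁ zx)
        ... | inj₂ z∈D | no z≢y with partner-near z∈D (Graph.sym G vz) x∈ (inj₁ zx)
        ...   | refl = inj₂ (∈-++⁺ʳ (star (partner y)) (∈-++⁺ˡ (∈-map⁺ (λ t → t , partner t) (∈-others vz z≢y))))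
        go (inj₂ (inj₁ (inj₁ refl))) = ⊥-elim (disjoint y∈D x∈R)
        go (inj₂ (inj₁ (inj₂ yx))) = hit (inj₁ yx)
        go (inj₂ (inj₂ (inj₁ refl))) = hit (inj₁ zx)
        go (inj₂ (inj₂ (inj₂ yz))) with closed x∈R xz | z ≟ v
        ... | inj₂ z∈D | _ = hit (inj₂ (_ , z∈D , yz , zx))
        ... | inj₁ _ | yes refl = ⊥-elim (isolated _ x∈R zx)
        ... | inj₁ z∈R | no z≢v = hit′ (∈∖⁺ z∈R z≢v) (inj₁ yz)
      cover : ∀ {x z} → Coloured (R ∖ v) x z → Conflict v y x z → ListsEdge L x z
      cover (xz , inj₁ x∈) conf = coverR x∈ xz conf
      cover (xz , inj₂ z∈) conf = Sum.swap (coverR z∈ (Graph.sym G xz) (Sum.map Sum.swap Sum.swap conf))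

    -- By `closed`, the edges that become coloured when `v` returns are exactly those from `v` to
    -- `D`.
    restore : ∀ {R D v} {c : Colours {3 * Δ}} → State G R D → v ∈ R → Proper c (Coloured (R ∖ v)) →
              (∀ {y} → y ∈ D → Adj G v y → Forbidden {3 * Δ} (Coloured (R ∖ v)) v y) →
              ∃ λ (c′ : Colours {3 * Δ}) → Proper c′ (Coloured R)
    restore {R} {D} {v} st v∈R proper forbid = map₂ (proper-mono cases)
      (addStar v ys proper λ y∈ → let y∈N , y∈D = ∈-filter⁻ (_∈? D) {xs = neighbours v} y∈
                                      vy = proj₂ (∈-filter⁻ (adj? G v) {xs = allFin n} y∈N)
                                  in vy , forbid y∈D vy)
      where
      open State st
      ys = filter (_∈? D) (neighbours v)
      fromV : ∀ {z} → Adj G v z → Coloured (R ∖ v) v z ⊎ ∃ λ y → y ∈ˡ ys × SameEdge v y v z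
      fromV {z} vz with closed v∈R vz
      ... | inj₁ z∈R = inj₁ (vz , inj₂ (∈∖⁺ z∈R λ { refl → irrefl G vz }))
      ... | inj₂ z∈D = inj₂ (z , ∈-filter⁺ (_∈? D) (∈-neighbours vz) z∈D , inj₁ (refl , refl))
      flip : ∀ {x z} → Coloured (R ∖ v) x z ⊎ (∃ λ y → y ∈ˡ ys × SameEdge v y x z) →
             Coloured (R ∖ v) z x ⊎ (∃ λ y → y ∈ˡ ys × SameEdge v y z x)
      flip (inj₁ (xz , h)) = inj₁ (Graph.sym G xz , Sum.swap h)
      flip (inj₂ (y , y∈ , same)) = inj₂ (y , y∈ , Sum.swap same)
      fromR : ∀ {x z} → x ∈ R → Adj G x z → Coloured (R ∖ v) x z ⊎ ∃ λ y → y ∈ˡ ys × SameEdge v y x z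
      fromR {x} x∈ xz with x ≟ v
      ... | yes refl = fromV xz
      ... | no x≢v = inj₁ (xz , inj₁ (∈∖⁺ x∈ x≢v))
      cases : ∀ {x z} → Coloured R x z → Coloured (R ∖ v) x z ⊎ ∃ λ y → y ∈ˡ ys × SameEdge v y x z
      cases (xz , inj₁ x∈) = fromR x∈ xz
      cases (xz , inj₂ z∈) = flip (fromR z∈ (Graph.sym G xz))

    colour : ∀ {R D} → Fin (3 * Δ) → Acc _⊂_ R → State G R D → ∃ λ (c : Colours {3 * Δ}) → Proper c (Coloured R)
    colour {R} {D} c₀ (acc rec) st with nonempty? R
    -- No edge meets the empty set, so the constant colouring will do.
    ... | no empty = (λ _ _ → c₀) , (λ _ _ → refl) , λ (_ , h) → ⊥-elim ([ empty ∘ (_ ,_) , empty ∘ (_ ,_) ]′ h)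
    ... | yes ne with reducible E? (adj? G) E-sym E-irr E⊆R adj⇒E separate ne
      where open State st
    ...   | v , v∈R , inj₁ (p , q , nbrs-v) =
            restore st v∈R (proj₂ (colour c₀ (rec (∖-⊂ v∈R)) (suppress G st v∈R nbrs-v)))
              λ y∈D vy → forbid-suppressed st v∈R y∈D vy nbrs-v
    ...   | v , v∈R , inj₂ isolated =
            restore st v∈R (proj₂ (colour c₀ (rec (∖-⊂ v∈R)) (discard G st isolated)))
              λ y∈D vy → forbid-discarded st v∈R y∈D vy isolated

  proper⇒strong : ∀ {k} {c : Colours {k}} → Proper c (Coloured ⊤) → StrongChromaticIndex≤ G k
  proper⇒strong {c = c} (symm , ok) =
    record { col = λ u v _ → c u v ; symm = λ u v _ _ → symm u v } , λ u v x y uv xy distinct eq →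
      let apart = λ conf → ok {u} {v} {x} {y} (uv , inj₁ ∈⊤) (xy , inj₁ ∈⊤) distinct conf eq in
      (apart ∘ inj₁ ∘ inj₁ ∘ inj₁) , (apart ∘ inj₁ ∘ inj₂ ∘ inj₁) ,
      (apart ∘ inj₂ ∘ inj₁ ∘ inj₁) , (apart ∘ inj₂ ∘ inj₂ ∘ inj₁) ,
      (apart ∘ inj₁ ∘ inj₁ ∘ inj₂) , (apart ∘ inj₁ ∘ inj₂ ∘ inj₂) ,
      (apart ∘ inj₂ ∘ inj₁ ∘ inj₂) , (apart ∘ inj₂ ∘ inj₂ ∘ inj₂)

  strongIndex≤3Δ : Chordless G → ∀ Δ → (∀ v → degree G v ≤ Δ) → StrongChromaticIndex≤ G (3 * Δ)
  -- `colour` starts from some colour, and `Fin 0` offers none; but here there are no edges.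
  strongIndex≤3Δ ch zero degree≤ =
    record { col = λ u v uv → ⊥-elim (noEdge uv) ; symm = λ u v uv → ⊥-elim (noEdge uv) } ,
    λ u v x y uv → ⊥-elim (noEdge uv)
    where
    noEdge : ∀ {u v} → ¬ Adj G u v
    noEdge uv with <-≤-trans (length-others uv) (degree≤ _)
    ... | ()
  strongIndex≤3Δ ch (suc Δ) degree≤ =
    proper⇒strong (proj₂ (Greedy.colour degree≤ zero (⊂-wellFounded ⊤) (initial G ch)))

theorem1 : ∀ {n} (G : Graph n) → Chordless G → StrongChromaticIndex≤ G (3 * maxDegree G)
theorem1 G ch = strongIndex≤3Δ G ch (maxDegree G) (degree≤maxDegree G)
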